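{- Let $A \subseteq \mathbb{N}$. If there exists an increasing sequence $(a_n)$ of elements of $A$ such that $a_{n-1}/a_n \to 1$ as $n \to +\infty$, then $D^k(A)$ is dense in $S^{k-1}$ for every integer $k \geq 2$.
   Context: $\mathbb{N}$ denotes the set of positive integers and $\|\cdot\|$ the Euclidean norm. "Increasing" means strictly increasing. For every integer $k \geq 2$, put $S^{k-1} := \{\boldsymbol{x} \in [0,1]^k : \|\boldsymbol{x}\| = 1\}$ (the part of the unit sphere of $\mathbb{R}^k$ with nonnegative coordinates), with the subspace topology from $\mathbb{R}^k$, and for $A \subseteq \mathbb{N}$ put $D^k(A) := \{\boldsymbol{a}/\|\boldsymbol{a}\| : \boldsymbol{a} \in A^k\} \subseteq S^{k-1}$. -}

module Defs where

open import Data.Nat.Base as ℕ using (ℕ; zero; suc; NonZero)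
import Data.Nat.Properties as ℕ
import Data.Nat.DivMod as ℕ
open import Data.Integer.Base as ℤ using (+_)
import Data.Integer.Properties as ℤ
import Data.Integer.Solver as ℤ
open import Data.Rational.Base as ℚ using (ℚ; 0ℚ; 1ℚ; ½)
import Data.Rational.Properties as ℚ
import Data.Rational.Unnormalised.Base as ℚᵘ
import Data.Rational.Unnormalised.Properties as ℚᵘ
open import Data.Rational.Solver using (module +-*-Solver)
open import Data.Product.Base using (Σ-syntax; ∃-syntax; _×_; _,_; proj₁; proj₂)
open import Data.Sum.Base using (inj₁; inj₂)
open import Data.Vec.Functional using (Vector; foldr)
open import Level as Level using (0ℓ)
open import Relation.Binary.PropositionalEquality
open import Relation.Nullary using (yes; no; contradiction)
open import Relation.Unary using (Pred; _∈_; _∩_; Satisfiable)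

record ℕ⁺ : Set where
  constructor mkℕ⁺
  field
    val : ℕ
    .{{val≢0}} : NonZero val

open ℕ⁺ public using (val)

infixl 7 _/⁺_

_/⁺_ : ℕ⁺ → ℕ⁺ → ℚ
mkℕ⁺ m /⁺ mkℕ⁺ n = + m ℚ./ n

isqrt : ℕ → ℕ
isqrt zero = 0
isqrt (suc n) with suc (isqrt n) ℕ.* suc (isqrt n) ℕ.≤? suc n
... | yes _ = suc (isqrt n)
... | no  _ = isqrt n

1/1+ : ℕ → ℚ
1/1+ n = + 1 ℚ./ suc n

-- For r = max(q,0) = c/d this is ⌊√(c(n+1)²/d)⌋/(n+1), i.e. the largest
-- multiple s of 1/(n+1) with s² ≤ r; see √ℚ-lower and √ℚ-upper below.
√ℚ : ℕ → ℚ → ℚ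
√ℚ n q = + isqrt ((ℤ.∣ ℚ.↥ r ∣ ℕ.* (suc n ℕ.* suc n)) ℕ./ ℚ.↧ₙ r) ℚ./ suc n
  where r = q ℚ.⊔ 0ℚ

-- Reciprocal, with the junk value 0 at 0.
inv : ℚ → ℚ
inv q with q ℚ.≟ 0ℚ
... | yes _   = 0ℚ
... | no  q≢0 = (ℚ.1/ q) {{ℚ.≢-nonZero q≢0}}

isqrt-lower : ∀ n → isqrt n ℕ.* isqrt n ℕ.≤ n
isqrt-lower zero = ℕ.z≤n
isqrt-lower (suc n) with suc (isqrt n) ℕ.* suc (isqrt n) ℕ.≤? suc n
... | yes p = p
... | no  _ = ℕ.m≤n⇒m≤1+n (isqrt-lower n)

isqrt-upper : ∀ n → n ℕ.< suc (isqrt n) ℕ.* suc (isqrt n)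
isqrt-upper zero = ℕ.s≤s ℕ.z≤n
isqrt-upper (suc n) with suc (isqrt n) ℕ.* suc (isqrt n) ℕ.≤? suc n
... | yes _ = ℕ.≤-<-trans (isqrt-upper n) (ℕ.*-mono-< {m} {suc m} {m} {suc m} ℕ.≤-refl ℕ.≤-refl)
  where m = suc (isqrt n)
... | no  p = ℕ.≰⇒> p

module Rationals where
  open import Data.Rational.Base hiding (NonZero)

  x-x≡0 : ∀ x → x - x ≡ 0ℚ
  x-x≡0 = ℚ.+-inverseʳ

  p≤∣p∣ : ∀ p → p ≤ ∣ p ∣
  p≤∣p∣ p with ℚ.≤-total 0ℚ p
  ... | inj₁ 0≤p = ℚ.≤-reflexive (sym (ℚ.0≤p⇒∣p∣≡p 0≤p))
  ... | inj₂ p≤0 = ℚ.≤-trans p≤0 (ℚ.0≤∣p∣ p)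

  ∣p-q∣≡∣q-p∣ : ∀ p q → ∣ p - q ∣ ≡ ∣ q - p ∣
  ∣p-q∣≡∣q-p∣ p q = trans (cong ∣_∣ (solve 2 (λ p q → p :- q := :- (q :- p)) refl p q))
                          (ℚ.∣-p∣≡∣p∣ (q - p))
    where
    open +-*-Solver

  p≤q+∣p-q∣ : ∀ p q → p ≤ q + ∣ p - q ∣
  p≤q+∣p-q∣ p q = begin
    p              ≡⟨ solve 2 (λ p q → p := q :+ (p :- q)) refl p q ⟩
    q + (p - q)    ≤⟨ ℚ.+-monoʳ-≤ q (p≤∣p∣ (p - q)) ⟩
    q + ∣ p - q ∣  ∎
    where
    open +-*-Solver
    open ℚ.≤-Reasoning

  ∣∣≤ : ∀ {p q} → p ≤ q → - p ≤ q → ∣ p ∣ ≤ q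
  ∣∣≤ {p} p≤q -p≤q with ℚ.∣p∣≡p∨∣p∣≡-p p
  ... | inj₁ eq = ℚ.≤-trans (ℚ.≤-reflexive eq) p≤q
  ... | inj₂ eq = ℚ.≤-trans (ℚ.≤-reflexive eq) -p≤q

  ≤-shift : ∀ {p q r} → p ≤ q + r → p - q ≤ r
  ≤-shift {p} {q} {r} h = begin
    p - q      ≤⟨ ℚ.+-monoˡ-≤ (- q) h ⟩
    q + r - q  ≡⟨ solve 2 (λ q r → q :+ r :- q := r) refl q r ⟩
    r          ∎
    where
    open +-*-Solver
    open ℚ.≤-Reasoning

  ∣∣p∣-∣q∣∣≤∣p-q∣ : ∀ p q → ∣ ∣ p ∣ - ∣ q ∣ ∣ ≤ ∣ p - q ∣
  ∣∣p∣-∣q∣∣≤∣p-q∣ p q = ∣∣≤ (half p q) (begin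
    - (∣ p ∣ - ∣ q ∣)  ≡⟨ solve 2 (λ a b → :- (a :- b) := b :- a) refl ∣ p ∣ ∣ q ∣ ⟩
    ∣ q ∣ - ∣ p ∣      ≤⟨ half q p ⟩
    ∣ q - p ∣          ≡⟨ ∣p-q∣≡∣q-p∣ q p ⟩
    ∣ p - q ∣          ∎)
    where
    open +-*-Solver
    open ℚ.≤-Reasoning
    half : ∀ p q → ∣ p ∣ - ∣ q ∣ ≤ ∣ p - q ∣
    half p q = ≤-shift (begin
      ∣ p ∣              ≡⟨ cong ∣_∣ (solve 2 (λ p q → p := q :+ (p :- q)) refl p q) ⟩
      ∣ q + (p - q) ∣    ≤⟨ ℚ.∣p+q∣≤∣p∣+∣q∣ q (p - q) ⟩
      ∣ q ∣ + ∣ p - q ∣  ∎)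

  0<p*q : ∀ {p q} → 0ℚ < p → 0ℚ < q → 0ℚ < p * q
  0<p*q {p} {q} 0<p 0<q =
    ℚ.positive⁻¹ (p * q) {{ℚ.pos*pos⇒pos p {{positive 0<p}} q {{positive 0<q}}}}

  0<½ε : ∀ {ε} → 0ℚ < ε → 0ℚ < ½ * ε
  0<½ε = 0<p*q (ℚ.positive⁻¹ ½)

  ½ε+½ε≡ε : ∀ ε → ½ * ε + ½ * ε ≡ ε
  ½ε+½ε≡ε = solve 1 (λ ε → con ½ :* ε :+ con ½ :* ε := ε) refl
    where
    open +-*-Solver

  *-mono-≤-nonNeg : ∀ {p q r s} → 0ℚ ≤ r → 0ℚ ≤ q → p ≤ q → r ≤ s → p * r ≤ q * s
  *-mono-≤-nonNeg {p} {q} {r} {s} 0≤r 0≤q p≤q r≤s = ℚ.≤-trans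
    (ℚ.*-monoʳ-≤-nonNeg r {{nonNegative 0≤r}} p≤q)
    (ℚ.*-monoˡ-≤-nonNeg q {{nonNegative 0≤q}} r≤s)

  *-inv : ∀ {q} → 0ℚ < q → q * inv q ≡ 1ℚ
  *-inv {q} 0<q with q ℚ.≟ 0ℚ
  ... | yes q≡0 = contradiction (sym q≡0) (ℚ.<⇒≢ 0<q)
  ... | no  q≢0 = ℚ.*-inverseʳ q {{≢-nonZero q≢0}}

  0<inv : ∀ {q} → 0ℚ < q → 0ℚ < inv q
  0<inv {q} 0<q = ℚ.*-cancelˡ-<-nonNeg q {{nonNegative (ℚ.<⇒≤ 0<q)}}
    (subst₂ _<_ (sym (ℚ.*-zeroʳ q)) (sym (*-inv 0<q)) (ℚ.positive⁻¹ 1ℚ))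

  toℚᵘ-/ : ∀ i n → toℚᵘ (i / suc n) ℚᵘ.≃ ℚᵘ.mkℚᵘ i n
  toℚᵘ-/ i n = ℚ.toℚᵘ-fromℚᵘ (ℚᵘ.mkℚᵘ i n)

  toℚᵘ-square : ∀ i n →
    toℚᵘ ((i / suc n) * (i / suc n)) ℚᵘ.≃ ℚᵘ.mkℚᵘ i n ℚᵘ.* ℚᵘ.mkℚᵘ i n
  toℚᵘ-square i n = ℚᵘ.≃-trans (ℚ.toℚᵘ-homo-* (i / suc n) (i / suc n))
    (ℚᵘ.*-cong (toℚᵘ-/ i n) (toℚᵘ-/ i n))

  0≤+/ : ∀ j n → 0ℚ ≤ + j / suc n
  0≤+/ j n = ℚ.nonNegative⁻¹ (+ j / suc n) {{ℚ.normalize-nonNeg j (suc n)}}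

  +/-suc : ∀ j n → + suc j / suc n ≡ + j / suc n + 1/1+ n
  +/-suc j n = ℚ.toℚᵘ-injective (begin
    toℚᵘ (+ suc j / suc n)                       ≈⟨ toℚᵘ-/ (+ suc j) n ⟩
    ℚᵘ.mkℚᵘ (+ suc j) n                          ≈⟨ ℚᵘ.*≡* eq ⟩
    ℚᵘ.mkℚᵘ (+ j) n ℚᵘ.+ ℚᵘ.mkℚᵘ (+ 1) n         ≈⟨ ℚᵘ.+-cong (toℚᵘ-/ (+ j) n) (toℚᵘ-/ (+ 1) n) ⟨
    toℚᵘ (+ j / suc n) ℚᵘ.+ toℚᵘ (1/1+ n)        ≈⟨ ℚ.toℚᵘ-homo-+ (+ j / suc n) (1/1+ n) ⟨
    toℚᵘ (+ j / suc n + 1/1+ n)                  ∎)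
    where
    open import Relation.Binary.Reasoning.Setoid ℚᵘ.≃-setoid
    eq : + suc j ℤ.* + (suc n ℕ.* suc n) ≡ (+ j ℤ.* + suc n ℤ.+ + 1 ℤ.* + suc n) ℤ.* + suc n
    eq = trans (cong (+ suc j ℤ.*_) (ℤ.pos-* (suc n) (suc n)))
      (solve 2 (λ J N → (con (+ 1) :+ J) :* (N :* N) := (J :* N :+ con (+ 1) :* N) :* N) refl (+ j) (+ suc n))
      where
      open ℤ.+-*-Solver

  0≤q⊔0 : ∀ q → 0ℚ ≤ q ⊔ 0ℚ
  0≤q⊔0 q = ℚ.p≤q⊔p q 0ℚ

  ↥-nonNeg : ∀ {r} → 0ℚ ≤ r → + ℤ.∣ ↥ r ∣ ≡ ↥ r
  ↥-nonNeg {r@record{}} 0≤r = ℤ.0≤i⇒+∣i∣≡i (ℤ.nonNegative⁻¹ (↥ r) {{nonNegative 0≤r}})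

  square-≤ : ∀ n j r → 0ℚ ≤ r → j ℕ.* j ℕ.* ↧ₙ r ℕ.≤ ℤ.∣ ↥ r ∣ ℕ.* (suc n ℕ.* suc n) →
             (+ j / suc n) * (+ j / suc n) ≤ r
  square-≤ n j r@record{} 0≤r h = ℚ.toℚᵘ-cancel-≤
    (ℚᵘ.≤-respˡ-≃ (ℚᵘ.≃-sym (toℚᵘ-square (+ j) n)) (ℚᵘ.*≤* (subst₂ ℤ._≤_
      (trans (ℤ.pos-* (j ℕ.* j) (↧ₙ r)) (cong (ℤ._* ↧ r) (ℤ.pos-* j j)))
      (trans (ℤ.pos-* ℤ.∣ ↥ r ∣ N) (cong (ℤ._* + N) (↥-nonNeg 0≤r)))
      (ℤ.+≤+ h))))
    where N = suc n ℕ.* suc n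

  square-> : ∀ n j r → 0ℚ ≤ r → ℤ.∣ ↥ r ∣ ℕ.* (suc n ℕ.* suc n) ℕ.< j ℕ.* j ℕ.* ↧ₙ r →
             r < (+ j / suc n) * (+ j / suc n)
  square-> n j r@record{} 0≤r h = ℚ.toℚᵘ-cancel-<
    (ℚᵘ.<-respʳ-≃ (ℚᵘ.≃-sym (toℚᵘ-square (+ j) n)) (ℚᵘ.*<* (subst₂ ℤ._<_
      (trans (ℤ.pos-* ℤ.∣ ↥ r ∣ N) (cong (ℤ._* + N) (↥-nonNeg 0≤r)))
      (trans (ℤ.pos-* (j ℕ.* j) (↧ₙ r)) (cong (ℤ._* ↧ r) (ℤ.pos-* j j)))
      (ℤ.+<+ h))))
    where N = suc n ℕ.* suc n

  √ℚ-nonNeg : ∀ n q → 0ℚ ≤ √ℚ n q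
  √ℚ-nonNeg n q = 0≤+/ (isqrt ((ℤ.∣ ↥ (q ⊔ 0ℚ) ∣ ℕ.* (suc n ℕ.* suc n)) ℕ./ ↧ₙ (q ⊔ 0ℚ))) n

  √ℚ-lower : ∀ n q → √ℚ n q * √ℚ n q ≤ q ⊔ 0ℚ
  √ℚ-lower n q = square-≤ n (isqrt (M ℕ./ ↧ₙ r)) r (0≤q⊔0 q)
    (ℕ.≤-trans (ℕ.*-monoˡ-≤ (↧ₙ r) (isqrt-lower (M ℕ./ ↧ₙ r))) (ℕ.m/n*n≤m M (↧ₙ r)))
    where
    r = q ⊔ 0ℚ
    M = ℤ.∣ ↥ r ∣ ℕ.* (suc n ℕ.* suc n)

  m/n<o⇒m<o*n : ∀ m o n .{{_ : NonZero n}} → m ℕ./ n ℕ.< o → m ℕ.< o ℕ.* n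
  m/n<o⇒m<o*n m o n m/n<o = ℕ.≰⇒> λ o*n≤m → ℕ.<⇒≱ m/n<o
    (ℕ.≤-trans (ℕ.≤-reflexive (sym (ℕ.m*n/n≡m o n))) (ℕ./-monoˡ-≤ n o*n≤m))

  √ℚ-upper : ∀ n q → q ⊔ 0ℚ < (√ℚ n q + 1/1+ n) * (√ℚ n q + 1/1+ n)
  √ℚ-upper n q = subst (λ s → r < s * s) (+/-suc j n)
    (square-> n (suc j) r (0≤q⊔0 q)
      (m/n<o⇒m<o*n M (suc j ℕ.* suc j) (↧ₙ r) (isqrt-upper (M ℕ./ ↧ₙ r))))
    where
    r = q ⊔ 0ℚ
    M = ℤ.∣ ↥ r ∣ ℕ.* (suc n ℕ.* suc n)
    j = isqrt (M ℕ./ ↧ₙ r)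

  archimedean : ∀ {ε} → 0ℚ < ε → ∃[ N ] ∀ n → N ℕ.≤ n → 1/1+ n < ε
  archimedean {ε@record{}} 0<ε = d , λ n d≤n → ℚ.toℚᵘ-cancel-<
    (ℚᵘ.<-respˡ-≃ (ℚᵘ.≃-sym (toℚᵘ-/ (+ 1) n)) (ℚᵘ.*<* (bound n d≤n)))
    where
    d = ↧ₙ ε
    bound : ∀ n → d ℕ.≤ n → + 1 ℤ.* + d ℤ.< ↥ ε ℤ.* + suc n
    bound n d≤n = begin-strict
      + 1 ℤ.* + d        ≡⟨ ℤ.*-identityˡ (+ d) ⟩
      + d                <⟨ ℤ.+<+ (ℕ.s≤s d≤n) ⟩
      + suc n            ≡⟨ ℤ.*-identityˡ (+ suc n) ⟨
      + 1 ℤ.* + suc n    ≤⟨ ℤ.*-monoʳ-≤-nonNeg (+ suc n) (ℤ.i<j⇒suc[i]≤j (ℤ.positive⁻¹ (↥ ε) {{positive 0<ε}})) ⟩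
      ↥ ε ℤ.* + suc n    ∎
      where
      open ℤ.≤-Reasoning

  √ℚ-gap : ∀ {ε} m n p q → 0ℚ < ε → 1/1+ n < ½ * ε → ε ≤ √ℚ m p - √ℚ n q →
           (½ * ε) * (½ * ε) ≤ ∣ p - q ∣
  √ℚ-gap {ε} m n p q 0<ε η<½ε ε≤s-t = ℚ.≮⇒≥ λ h → ℚ.<-irrefl refl (begin-strict
    s * s                      ≤⟨ √ℚ-lower m p ⟩
    p ⊔ 0ℚ                     ≤⟨ ⊔-bound ⟩
    q ⊔ 0ℚ + ∣ p - q ∣         <⟨ ℚ.+-mono-< (√ℚ-upper n q) h ⟩
    u * u + e * e              ≡⟨ ℚ.+-identityʳ (u * u + e * e) ⟨
    u * u + e * e + 0ℚ         ≤⟨ ℚ.+-monoʳ-≤ (u * u + e * e) 0≤2ue ⟩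
    u * u + e * e + (u * e + u * e)
      ≡⟨ solve 2 (λ u e → u :* u :+ e :* e :+ (u :* e :+ u :* e) := (u :+ e) :* (u :+ e)) refl u e ⟩
    (u + e) * (u + e)          ≤⟨ *-mono-≤-nonNeg 0≤u+e (√ℚ-nonNeg m p) u+e≤s u+e≤s ⟩
    s * s                      ∎)
    where
    open +-*-Solver
    open ℚ.≤-Reasoning
    s = √ℚ m p
    t = √ℚ n q
    e = ½ * ε
    u = t + 1/1+ n
    0≤e : 0ℚ ≤ e
    0≤e = ℚ.<⇒≤ (0<½ε 0<ε)
    0≤u : 0ℚ ≤ u
    0≤u = ℚ.+-mono-≤ (√ℚ-nonNeg n q) (0≤+/ 1 n)
    0≤u+e : 0ℚ ≤ u + e
    0≤u+e = ℚ.+-mono-≤ 0≤u 0≤e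
    0≤ue : 0ℚ ≤ u * e
    0≤ue = subst (_≤ u * e) (ℚ.*-zeroʳ 0ℚ) (*-mono-≤-nonNeg ℚ.≤-refl 0≤u 0≤u 0≤e)
    0≤2ue : 0ℚ ≤ u * e + u * e
    0≤2ue = ℚ.+-mono-≤ 0≤ue 0≤ue
    u+e≤s : u + e ≤ s
    u+e≤s = begin
      t + 1/1+ n + e  ≤⟨ ℚ.+-monoˡ-≤ e (ℚ.+-monoʳ-≤ t (ℚ.<⇒≤ η<½ε)) ⟩
      t + e + e       ≡⟨ ℚ.+-assoc t e e ⟩
      t + (e + e)     ≡⟨ cong (λ z → t + z) (½ε+½ε≡ε ε) ⟩
      t + ε           ≤⟨ ℚ.+-monoʳ-≤ t ε≤s-t ⟩
      t + (s - t)     ≡⟨ solve 2 (λ s t → t :+ (s :- t) := s) refl s t ⟩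
      s               ∎
    ⊔-bound : p ⊔ 0ℚ ≤ q ⊔ 0ℚ + ∣ p - q ∣
    ⊔-bound = ℚ.⊔-lub
      (ℚ.≤-trans (p≤q+∣p-q∣ p q) (ℚ.+-monoˡ-≤ ∣ p - q ∣ (ℚ.p≤p⊔q q 0ℚ)))
      (ℚ.+-mono-≤ (0≤q⊔0 q) (ℚ.0≤∣p∣ (p - q)))

open Rationals using (√ℚ-lower; √ℚ-upper) public

IsCauchy : (ℕ → ℚ) → Set
IsCauchy x = ∀ ε → 0ℚ ℚ.< ε →
  ∃[ N ] ∀ m n → N ℕ.≤ m → N ℕ.≤ n → ℚ.∣ x m ℚ.- x n ∣ ℚ.< ε

module Cauchy where
  open import Data.Rational.Base hiding (NonZero)
  open Rationals
  open +-*-Solver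
  open ℚ.≤-Reasoning

  const-cauchy : ∀ q → IsCauchy (λ _ → q)
  const-cauchy q ε 0<ε = 0 , λ _ _ _ _ → subst (λ d → ∣ d ∣ < ε) (sym (x-x≡0 q)) 0<ε

  +-cauchy : ∀ x y → IsCauchy x → IsCauchy y → IsCauchy (λ n → x n + y n)
  +-cauchy x y cx cy ε 0<ε with cx (½ * ε) (0<½ε 0<ε) | cy (½ * ε) (0<½ε 0<ε)
  ... | M , hx | N , hy = M ℕ.⊔ N , λ m n ≤m ≤n → begin-strict
      ∣ x m + y m - (x n + y n) ∣
        ≡⟨ cong ∣_∣ (solve 4 (λ a b c d → a :+ b :- (c :+ d) := a :- c :+ (b :- d)) refl (x m) (y m) (x n) (y n)) ⟩
      ∣ x m - x n + (y m - y n) ∣    ≤⟨ ℚ.∣p+q∣≤∣p∣+∣q∣ (x m - x n) (y m - y n) ⟩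
      ∣ x m - x n ∣ + ∣ y m - y n ∣
        <⟨ ℚ.+-mono-< (hx m n (ℕ.m⊔n≤o⇒m≤o M N ≤m) (ℕ.m⊔n≤o⇒m≤o M N ≤n))
                      (hy m n (ℕ.m⊔n≤o⇒n≤o M N ≤m) (ℕ.m⊔n≤o⇒n≤o M N ≤n)) ⟩
      ½ * ε + ½ * ε                  ≡⟨ ½ε+½ε≡ε ε ⟩
      ε                              ∎

  contract-cauchy : ∀ x y → (∀ m n → ∣ y m - y n ∣ ≤ ∣ x m - x n ∣) → IsCauchy x → IsCauchy y
  contract-cauchy x y h cx ε 0<ε with cx ε 0<ε
  ... | N , hx = N , λ m n N≤m N≤n → ℚ.≤-<-trans (h m n) (hx m n N≤m N≤n)

  neg-cauchy : ∀ x → IsCauchy x → IsCauchy (λ n → - x n)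
  neg-cauchy x = contract-cauchy x (λ n → - x n) λ m n → ℚ.≤-reflexive
    (trans (cong ∣_∣ (solve 2 (λ p q → :- p :- :- q := :- (p :- q)) refl (x m) (x n)))
           (ℚ.∣-p∣≡∣p∣ (x m - x n)))

  abs-cauchy : ∀ x → IsCauchy x → IsCauchy (λ n → ∣ x n ∣)
  abs-cauchy x = contract-cauchy x (λ n → ∣ x n ∣) λ m n → ∣∣p∣-∣q∣∣≤∣p-q∣ (x m) (x n)

  bounded : ∀ x → IsCauchy x → ∃[ K ] 0ℚ < K × ∃[ N ] ∀ n → N ℕ.≤ n → ∣ x n ∣ ≤ K
  bounded x cx with cx 1ℚ (ℚ.positive⁻¹ 1ℚ)
  ... | N , hx = ∣ x N ∣ + 1ℚ
    , ℚ.+-mono-≤-< (ℚ.0≤∣p∣ (x N)) (ℚ.positive⁻¹ 1ℚ)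
    , N , λ n N≤n → begin
      ∣ x n ∣                  ≡⟨ cong ∣_∣ (solve 2 (λ p q → p := q :+ (p :- q)) refl (x n) (x N)) ⟩
      ∣ x N + (x n - x N) ∣    ≤⟨ ℚ.∣p+q∣≤∣p∣+∣q∣ (x N) (x n - x N) ⟩
      ∣ x N ∣ + ∣ x n - x N ∣  ≤⟨ ℚ.+-monoʳ-≤ ∣ x N ∣ (ℚ.<⇒≤ (hx n N N≤n ℕ.≤-refl)) ⟩
      ∣ x N ∣ + 1ℚ             ∎

  scaled : ∀ {K ε} a b → 0ℚ < K → ∣ a ∣ ≤ K → ∣ b ∣ < inv K * ε → ∣ a * b ∣ < ε
  scaled {K} {ε} a b 0<K a≤K b< = begin-strict
    ∣ a * b ∣        ≡⟨ ℚ.∣p*q∣≡∣p∣*∣q∣ a b ⟩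
    ∣ a ∣ * ∣ b ∣    ≤⟨ ℚ.*-monoʳ-≤-nonNeg ∣ b ∣ {{ℚ.∣-∣-nonNeg b}} a≤K ⟩
    K * ∣ b ∣        <⟨ ℚ.*-monoʳ-<-pos K {{positive 0<K}} b< ⟩
    K * (inv K * ε)  ≡⟨ ℚ.*-assoc K (inv K) ε ⟨
    K * inv K * ε    ≡⟨ cong (_* ε) (*-inv 0<K) ⟩
    1ℚ * ε           ≡⟨ ℚ.*-identityˡ ε ⟩
    ε                ∎

  product-difference : ∀ a b c d → a * b - c * d ≡ a * (b - d) + d * (a - c)
  product-difference =
    solve 4 (λ a b c d → a :* b :- c :* d := a :* (b :- d) :+ d :* (a :- c)) refl

  product-close : ∀ {ε K L} a b c d → 0ℚ < K → 0ℚ < L → ∣ a ∣ ≤ K → ∣ d ∣ ≤ L →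
    ∣ b - d ∣ < inv K * (½ * ε) → ∣ a - c ∣ < inv L * (½ * ε) → ∣ a * b - c * d ∣ < ε
  product-close {ε} a b c d 0<K 0<L a≤K d≤L b-d< a-c< = begin-strict
    ∣ a * b - c * d ∣                  ≡⟨ cong ∣_∣ (product-difference a b c d) ⟩
    ∣ a * (b - d) + d * (a - c) ∣      ≤⟨ ℚ.∣p+q∣≤∣p∣+∣q∣ (a * (b - d)) (d * (a - c)) ⟩
    ∣ a * (b - d) ∣ + ∣ d * (a - c) ∣
      <⟨ ℚ.+-mono-< (scaled a (b - d) 0<K a≤K b-d<) (scaled d (a - c) 0<L d≤L a-c<) ⟩
    ½ * ε + ½ * ε                      ≡⟨ ½ε+½ε≡ε ε ⟩
    ε                                  ∎

  *-cauchy : ∀ x y → IsCauchy x → IsCauchy y → IsCauchy (λ n → x n * y n)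
  *-cauchy x y cx cy ε 0<ε = *-close (bounded x cx) (bounded y cy)
    where
    *-close : ∃[ K ] 0ℚ < K × (∃[ M ] ∀ n → M ℕ.≤ n → ∣ x n ∣ ≤ K) →
              ∃[ L ] 0ℚ < L × (∃[ M ] ∀ n → M ℕ.≤ n → ∣ y n ∣ ≤ L) →
              ∃[ N ] ∀ m n → N ℕ.≤ m → N ℕ.≤ n → ∣ x m * y m - x n * y n ∣ < ε
    *-close (K , 0<K , M₁ , bx) (L , 0<L , M₂ , by) =
      (M₁ ℕ.⊔ M₂) ℕ.⊔ (N₁ ℕ.⊔ N₂) , λ m n ≤m ≤n →
        product-close (x m) (y m) (x n) (y n) 0<K 0<L
          (bx m (ℕ.m⊔n≤o⇒m≤o M₁ M₂ (ℕ.m⊔n≤o⇒m≤o (M₁ ℕ.⊔ M₂) (N₁ ℕ.⊔ N₂) ≤m)))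
          (by n (ℕ.m⊔n≤o⇒n≤o M₁ M₂ (ℕ.m⊔n≤o⇒m≤o (M₁ ℕ.⊔ M₂) (N₁ ℕ.⊔ N₂) ≤n)))
          (proj₂ hy m n (N₂≤ m ≤m) (N₂≤ n ≤n))
          (proj₂ hx m n (N₁≤ m ≤m) (N₁≤ n ≤n))
      where
      hx = cx (inv L * (½ * ε)) (0<p*q (0<inv 0<L) (0<½ε 0<ε))
      hy = cy (inv K * (½ * ε)) (0<p*q (0<inv 0<K) (0<½ε 0<ε))
      N₁ = proj₁ hx
      N₂ = proj₁ hy
      N₁≤ : ∀ n → (M₁ ℕ.⊔ M₂) ℕ.⊔ (N₁ ℕ.⊔ N₂) ℕ.≤ n → N₁ ℕ.≤ n
      N₁≤ n h = ℕ.m⊔n≤o⇒m≤o N₁ N₂ (ℕ.m⊔n≤o⇒n≤o (M₁ ℕ.⊔ M₂) (N₁ ℕ.⊔ N₂) h)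
      N₂≤ : ∀ n → (M₁ ℕ.⊔ M₂) ℕ.⊔ (N₁ ℕ.⊔ N₂) ℕ.≤ n → N₂ ℕ.≤ n
      N₂≤ n h = ℕ.m⊔n≤o⇒n≤o N₁ N₂ (ℕ.m⊔n≤o⇒n≤o (M₁ ℕ.⊔ M₂) (N₁ ℕ.⊔ N₂) h)

  quotient-difference : ∀ p q p⁻¹ q⁻¹ →
    (p⁻¹ - q⁻¹) * (p * q) ≡ p * p⁻¹ * q - p * (q * q⁻¹)
  quotient-difference = solve 4 (λ p q p⁻¹ q⁻¹ →
    (p⁻¹ :- q⁻¹) :* (p :* q) := p :* p⁻¹ :* q :- p :* (q :* q⁻¹)) refl

  inv-cauchy : ∀ x → IsCauchy x →
    ∃[ δ ] 0ℚ < δ × (∃[ N ] ∀ n → N ℕ.≤ n → 0ℚ + δ ≤ x n) → IsCauchy (λ n → inv (x n))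
  inv-cauchy x cx (δ , 0<δ , M , δ≤x) ε 0<ε
    with cx (ε * (δ * δ)) (0<p*q 0<ε (0<p*q 0<δ 0<δ))
  ... | N , hx = M ℕ.⊔ N , λ m n ≤m ≤n →
      close m n (ℕ.m⊔n≤o⇒m≤o M N ≤m) (ℕ.m⊔n≤o⇒m≤o M N ≤n)
                (ℕ.m⊔n≤o⇒n≤o M N ≤m) (ℕ.m⊔n≤o⇒n≤o M N ≤n)
    where
    δ≤ : ∀ n → M ℕ.≤ n → δ ≤ x n
    δ≤ n M≤n = subst (_≤ x n) (ℚ.+-identityˡ δ) (δ≤x n M≤n)
    0<x : ∀ n → M ℕ.≤ n → 0ℚ < x n
    0<x n M≤n = ℚ.<-≤-trans 0<δ (δ≤ n M≤n)
    close : ∀ m n → M ℕ.≤ m → M ℕ.≤ n → N ℕ.≤ m → N ℕ.≤ n → ∣ inv (x m) - inv (x n) ∣ < ε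
    close m n M≤m M≤n N≤m N≤n =
      ℚ.*-cancelʳ-<-nonNeg (δ * δ) {{nonNegative (ℚ.<⇒≤ (0<p*q 0<δ 0<δ))}} (begin-strict
      ∣ d ∣ * (δ * δ)
        ≤⟨ ℚ.*-monoˡ-≤-nonNeg ∣ d ∣ {{ℚ.∣-∣-nonNeg d}}
             (*-mono-≤-nonNeg (ℚ.<⇒≤ 0<δ) (ℚ.<⇒≤ (0<x m M≤m)) (δ≤ m M≤m) (δ≤ n M≤n)) ⟩
      ∣ d ∣ * (p * q)
        ≡⟨ cong (∣ d ∣ *_) (ℚ.0≤p⇒∣p∣≡p (ℚ.<⇒≤ (0<p*q (0<x m M≤m) (0<x n M≤n)))) ⟨
      ∣ d ∣ * ∣ p * q ∣
        ≡⟨ ℚ.∣p*q∣≡∣p∣*∣q∣ d (p * q) ⟨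
      ∣ d * (p * q) ∣
        ≡⟨ cong ∣_∣ (quotient-difference p q (inv p) (inv q)) ⟩
      ∣ p * inv p * q - p * (q * inv q) ∣
        ≡⟨ cong₂ (λ a b → ∣ a * q - p * b ∣) (*-inv (0<x m M≤m)) (*-inv (0<x n M≤n)) ⟩
      ∣ 1ℚ * q - p * 1ℚ ∣
        ≡⟨ cong₂ (λ a b → ∣ a - b ∣) (ℚ.*-identityˡ q) (ℚ.*-identityʳ p) ⟩
      ∣ q - p ∣      <⟨ hx n m N≤n N≤m ⟩
      ε * (δ * δ)    ∎)
      where
      p = x m
      q = x n
      d = inv p - inv q

  √-cauchy : ∀ x → IsCauchy x → IsCauchy (λ n → √ℚ n (x n))
  √-cauchy x cx ε 0<ε = M ℕ.⊔ N , λ m n ≤m ≤n → abs-< (√ℚ m (x m)) (√ℚ n (x n))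
      (close m n (ℕ.m⊔n≤o⇒m≤o M N ≤m) (ℕ.m⊔n≤o⇒m≤o M N ≤n) (ℕ.m⊔n≤o⇒n≤o M N ≤n))
      (close n m (ℕ.m⊔n≤o⇒m≤o M N ≤n) (ℕ.m⊔n≤o⇒m≤o M N ≤m) (ℕ.m⊔n≤o⇒n≤o M N ≤m))
    where
    hx = cx ((½ * ε) * (½ * ε)) (0<p*q (0<½ε 0<ε) (0<½ε 0<ε))
    η = archimedean (0<½ε 0<ε)
    M = proj₁ hx
    N = proj₁ η
    close : ∀ m n → M ℕ.≤ m → M ℕ.≤ n → N ℕ.≤ n → √ℚ m (x m) - √ℚ n (x n) < ε
    close m n M≤m M≤n N≤n = ℚ.≰⇒> λ ε≤ → ℚ.<-irrefl refl
      (ℚ.<-≤-trans (proj₂ hx m n M≤m M≤n) (√ℚ-gap m n (x m) (x n) 0<ε (proj₂ η n N≤n) ε≤))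
    abs-< : ∀ p q → p - q < ε → q - p < ε → ∣ p - q ∣ < ε
    abs-< p q h h′ with ℚ.∣p∣≡p∨∣p∣≡-p (p - q)
    ... | inj₁ eq = subst (_< ε) (sym eq) h
    ... | inj₂ eq = subst (_< ε) (sym (trans eq (solve 2 (λ p q → :- (p :- q) := q :- p) refl p q))) h′

-- Reals are Cauchy sequences of rationals; their equality is _≈_, not _≡_.
record ℝ : Set where
  constructor mkℝ
  field
    seq    : ℕ → ℚ
    cauchy : IsCauchy seq

open ℝ public

infix 4 _≈_ _≤_ _<_
infixl 6 _+_ _-_
infixl 7 _*_ _÷_
infix 8 -_

-- x < y demands a positive rational gap that persists along a tail, whereas
-- x ≤ y only bounds x by y + ε eventually, for each rational ε > 0.
_≈_ : ℝ → ℝ → Set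
x ≈ y = ∀ ε → 0ℚ ℚ.< ε → ∃[ N ] ∀ n → N ℕ.≤ n → ℚ.∣ seq x n ℚ.- seq y n ∣ ℚ.< ε

_≤_ : ℝ → ℝ → Set
x ≤ y = ∀ ε → 0ℚ ℚ.< ε → ∃[ N ] ∀ n → N ℕ.≤ n → seq x n ℚ.≤ seq y n ℚ.+ ε

_<_ : ℝ → ℝ → Set
x < y = ∃[ ε ] 0ℚ ℚ.< ε × ∃[ N ] ∀ n → N ℕ.≤ n → seq x n ℚ.+ ε ℚ.≤ seq y n

fromℚ : ℚ → ℝ
fromℚ q = mkℝ (λ _ → q) (Cauchy.const-cauchy q)

fromℕ : ℕ → ℝ
fromℕ n = fromℚ (+ n ℚ./ 1)

0ℝ 1ℝ : ℝ
0ℝ = fromℚ 0ℚ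
1ℝ = fromℚ 1ℚ

_+_ : ℝ → ℝ → ℝ
x + y = mkℝ (λ n → seq x n ℚ.+ seq y n) (Cauchy.+-cauchy (seq x) (seq y) (cauchy x) (cauchy y))

-_ : ℝ → ℝ
- x = mkℝ (λ n → ℚ.- seq x n) (Cauchy.neg-cauchy (seq x) (cauchy x))

_-_ : ℝ → ℝ → ℝ
x - y = x + (- y)

_*_ : ℝ → ℝ → ℝ
x * y = mkℝ (λ n → seq x n ℚ.* seq y n) (Cauchy.*-cauchy (seq x) (seq y) (cauchy x) (cauchy y))

∣_∣ : ℝ → ℝ
∣ x ∣ = mkℝ (λ n → ℚ.∣ seq x n ∣) (Cauchy.abs-cauchy (seq x) (cauchy x))

recip : (x : ℝ) → 0ℝ < x → ℝ
recip x 0<x = mkℝ (λ n → inv (seq x n)) (Cauchy.inv-cauchy (seq x) (cauchy x) 0<x)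

_÷_ : ℝ → (y : ℝ) → 0ℝ < y → ℝ
(x ÷ y) 0<y = x * recip y 0<y

-- The square root of max(x,0).
√_ : ℝ → ℝ
√ x = mkℝ (λ n → √ℚ n (seq x n)) (Cauchy.√-cauchy (seq x) (cauchy x))

_⟶_ : (ℕ → ℝ) → ℝ → Set
x ⟶ l = ∀ ε → 0ℝ < ε → ∃[ N ] ∀ n → N ℕ.≤ n → ∣ x n - l ∣ < ε

infix 4 _≈ᵛ_
infixl 6 _-ᵛ_

ℝ^_ : ℕ → Set
ℝ^ k = Vector ℝ k

_≈ᵛ_ : ∀ {k} → ℝ^ k → ℝ^ k → Set
x ≈ᵛ y = ∀ i → x i ≈ y i

_-ᵛ_ : ∀ {k} → ℝ^ k → ℝ^ k → ℝ^ k
(x -ᵛ y) i = x i - y i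

‖_‖ : ∀ {k} → ℝ^ k → ℝ
‖ x ‖ = √ foldr _+_ 0ℝ (λ i → x i * x i)

IsOpen : ∀ {k} → Pred (ℝ^ k) 0ℓ → Set
IsOpen V = ∀ x → x ∈ V → ∃[ ε ] 0ℝ < ε × (∀ y → ‖ y -ᵛ x ‖ < ε → y ∈ V)

-- The nonempty open sets of the subspace S are the inhabited V ∩ S with V
-- open in ℝ^k.
_IsDenseIn_ : ∀ {k ℓ} → Pred (ℝ^ k) ℓ → Pred (ℝ^ k) 0ℓ → Set (Level.suc 0ℓ Level.⊔ ℓ)
D IsDenseIn S = ∀ V → IsOpen V → Satisfiable (V ∩ S) → Satisfiable (V ∩ S ∩ D)

Sphere⁺ : ∀ k → Pred (ℝ^ k) 0ℓ
Sphere⁺ k x = (∀ i → 0ℝ ≤ x i × x i ≤ 1ℝ) × ‖ x ‖ ≈ 1ℝ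

embed : ∀ {k} → Vector ℕ⁺ k → ℝ^ k
embed a i = fromℕ (val (a i))

-- The points a/‖a‖ with a ∈ A^k, closed under equality of reals.  The witness
-- 0<‖a‖ restricts nothing for k > 0, as all entries of a are positive; it is
-- there because division by a real needs it.
D^ : ∀ {ℓ} k → Pred ℕ⁺ ℓ → Pred (ℝ^ k) ℓ
D^ k A x = ∃[ a ] (∀ i → a i ∈ A) ×
  Σ[ 0<‖a‖ ∈ 0ℝ < ‖ embed a ‖ ] x ≈ᵛ (λ i → (embed a i ÷ ‖ embed a ‖) 0<‖a‖)

quotients : (ℕ → ℕ⁺) → ℕ → ℝ
quotients a n = fromℚ (a n /⁺ a (suc n))

Increasing : (ℕ → ℕ⁺) → Set
Increasing a = ∀ n → val (a n) ℕ.< val (a (suc n))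

{-# OPTIONS --safe #-}
module Submission where

-- If d = a_M is a term after which consecutive terms differ by a factor of at
-- most 1 + δ, then every real in [0, 2d/δ] is within 2d of some a_n.  For x on
-- the sphere put K = 1/δ and choose a ∈ A^k with |a i − d K x i| ≤ 2d: then
-- a/(d K) is within O(δ) of x, its norm is within O(k δ) of 1, and hence
-- a/‖a‖ is within O(k δ) of x in each coordinate.  All operations on ℝ act
-- termwise, so the estimates are made in ℚ, along a tail of the Cauchy sequences.

open import Defs using (module Rationals; inv; √ℚ; 1/1+; √ℚ-lower; √ℚ-upper)
open import Data.Nat.Base as ℕ using (ℕ; zero; suc)
import Data.Nat.Properties as ℕ
open import Data.Integer.Base as ℤ using (+_)
import Data.Integer.Properties as ℤ
open import Data.Fin.Base using (Fin; zero; suc)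
import Data.Rational.Base as ℚ
import Data.Rational.Properties as ℚ
open import Data.Rational.Base using (ℚ; 0ℚ; 1ℚ; ½; toℚᵘ)
import Data.Rational.Unnormalised.Base as ℚᵘ
import Data.Rational.Unnormalised.Properties as ℚᵘ
open import Data.Rational.Solver using (module +-*-Solver)
open import Algebra.Bundles using (CommutativeRing)
open import Algebra.Properties.Semiring.Sum
  (CommutativeRing.semiring ℚ.+-*-commutativeRing) using (sum; sum-cong-≗; *-distribʳ-sum)
open import Data.Product.Base using (Σ-syntax; ∃-syntax; _×_; _,_; proj₁; proj₂)
open import Data.Sum.Base using (inj₁; inj₂)
open import Relation.Binary.PropositionalEquality
open import Relation.Nullary using (yes; no; contradiction)

-- The scale `d K` balances two demands. Targets reach height about `d K`, where consecutive terms
-- differ by about `δ d K = d`, no more than the size of the starting term itself; and an error of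
-- `2 d` shrinks to `2 δ` after division by `d K`. So one bound covers both a target lying between
-- two late terms and a target close to 0, which no term approximates better than `d` does. The form
-- of the estimates comes from working with Cauchy sequences. Comparing a real with the terms of the
-- sequence is not decidable, so the indices are chosen from the rational approximants of `x` at a
-- single stage `m`, and the resulting integer vector must stay good at all later stages. At stage
-- `n` the norm is a square root rounded down to a multiple of `1/(n+1)`, so the approximants of
-- `a/‖a‖` are only almost unit vectors. This explains the two-sided bounds on squared lengths in
-- place of equations.

module Estimates where
  open import Data.Rational.Base hiding (NonZero; ℚ; 0ℚ; 1ℚ; ½; toℚᵘ)
  open Rationals
  open +-*-Solver

  -- Order and absolute value in ℚ

  2ℚ 3ℚ 4ℚ 8ℚ 10ℚ 21ℚ : ℚ
  2ℚ = + 2 / 1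
  3ℚ = + 3 / 1
  4ℚ = + 4 / 1
  8ℚ = + 8 / 1
  10ℚ = + 10 / 1
  21ℚ = + 21 / 1

  ℕ→ℚ : ℕ → ℚ
  ℕ→ℚ n = + n / 1

  0≤-+ : ∀ {p q} → 0ℚ ≤ p → 0ℚ ≤ q → 0ℚ ≤ p + q
  0≤-+ = ℚ.+-mono-≤

  0≤-* : ∀ {p q} → 0ℚ ≤ p → 0ℚ ≤ q → 0ℚ ≤ p * q
  0≤-* {p} {q} 0≤p 0≤q =
    ℚ.nonNegative⁻¹ (p * q) {{ℚ.nonNeg*nonNeg⇒nonNeg p {{nonNegative 0≤p}} q {{nonNegative 0≤q}}}}

  0≤q-p : ∀ {p q} → p ≤ q → 0ℚ ≤ q - p
  0≤q-p {p} {q} p≤q = subst (_≤ q - p) (ℚ.+-inverseʳ p) (ℚ.+-monoˡ-≤ (- p) p≤q)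

  -- Inequalities are proved by exhibiting the difference q − p as a visibly
  -- nonnegative expression r; the identity is left to the ring solver.
  ≤-by : ∀ {p q r} → 0ℚ ≤ r → q ≡ p + r → p ≤ q
  ≤-by {p} {q} {r} 0≤r q≡p+r = subst₂ _≤_ (ℚ.+-identityʳ p) (sym q≡p+r) (ℚ.+-monoʳ-≤ p 0≤r)

  0≤1 : 0ℚ ≤ 1ℚ
  0≤1 = ℚ.nonNegative⁻¹ 1ℚ

  p*p≡∣p∣*∣p∣ : ∀ p → p * p ≡ ∣ p ∣ * ∣ p ∣
  p*p≡∣p∣*∣p∣ p with ℚ.∣p∣≡p∨∣p∣≡-p p
  ... | inj₁ eq = sym (cong₂ _*_ eq eq)
  ... | inj₂ eq = sym (trans (cong₂ _*_ eq eq) (solve 1 (λ p → :- p :* :- p := p :* p) refl p))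

  0≤p*p : ∀ p → 0ℚ ≤ p * p
  0≤p*p p = subst (0ℚ ≤_) (sym (p*p≡∣p∣*∣p∣ p)) (0≤-* (ℚ.0≤∣p∣ p) (ℚ.0≤∣p∣ p))

  ∣p∣≤c⇒p*p≤c*c : ∀ {p c} → ∣ p ∣ ≤ c → p * p ≤ c * c
  ∣p∣≤c⇒p*p≤c*c {p} {c} h = subst (_≤ c * c) (sym (p*p≡∣p∣*∣p∣ p))
    (*-mono-≤-nonNeg (ℚ.0≤∣p∣ p) (ℚ.≤-trans (ℚ.0≤∣p∣ p) h) h h)

  ∣p∣≤c⇒-c≤p : ∀ {p c} → ∣ p ∣ ≤ c → - c ≤ p
  ∣p∣≤c⇒-c≤p {p} {c} h = ≤-by (0≤q-p (ℚ.≤-trans (p≤∣p∣ (- p)) (subst (_≤ c) (sym (ℚ.∣-p∣≡∣p∣ p)) h)))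
    (solve 2 (λ p c → p := :- c :+ (c :- :- p)) refl p c)

  p*p≤q*q⇒p≤q : ∀ {p q} → 0ℚ ≤ q → p * p ≤ q * q → p ≤ q
  p*p≤q*q⇒p≤q {p} {q} 0≤q h = ℚ.≮⇒≥ λ q<p → ℚ.<-irrefl refl (begin-strict
    q * q  ≤⟨ ℚ.*-monoˡ-≤-nonNeg q {{nonNegative 0≤q}} (ℚ.<⇒≤ q<p) ⟩
    q * p  <⟨ ℚ.*-monoˡ-<-pos p {{positive (ℚ.≤-<-trans 0≤q q<p)}} q<p ⟩
    p * p  ≤⟨ h ⟩
    q * q  ∎)
    where open ℚ.≤-Reasoning

  ∣p*q∣≤ : ∀ {p q c d} → ∣ p ∣ ≤ c → ∣ q ∣ ≤ d → ∣ p * q ∣ ≤ c * d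
  ∣p*q∣≤ {p} {q} {c} {d} hp hq = subst (_≤ c * d) (sym (ℚ.∣p*q∣≡∣p∣*∣q∣ p q))
    (*-mono-≤-nonNeg (ℚ.0≤∣p∣ q) (ℚ.≤-trans (ℚ.0≤∣p∣ p) hp) hp hq)

  ∣p+q∣≤ : ∀ {p q c d} → ∣ p ∣ ≤ c → ∣ q ∣ ≤ d → ∣ p + q ∣ ≤ c + d
  ∣p+q∣≤ {p} {q} hp hq = ℚ.≤-trans (ℚ.∣p+q∣≤∣p∣+∣q∣ p q) (ℚ.+-mono-≤ hp hq)

  -- Finite sums and sums of squares

  sum-≤ : ∀ {k c} (f : Fin k → ℚ) → (∀ i → f i ≤ c) → sum f ≤ ℕ→ℚ k * c
  sum-≤ {zero}  {c} f h = ℚ.≤-reflexive (sym (ℚ.*-zeroˡ c))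
  sum-≤ {suc k} {c} f h = begin
    f zero + sum (λ i → f (suc i))
      ≤⟨ ℚ.+-mono-≤ (h zero) (sum-≤ (λ i → f (suc i)) (λ i → h (suc i))) ⟩
    c + ℕ→ℚ k * c
      ≡⟨ solve 2 (λ c κ → c :+ κ :* c := (κ :+ con 1ℚ) :* c) refl c (ℕ→ℚ k) ⟩
    (ℕ→ℚ k + 1ℚ) * c
      ≡⟨ cong (_* c) (+/-suc k 0) ⟨
    ℕ→ℚ (suc k) * c ∎
    where open ℚ.≤-Reasoning

  sum-close : ∀ {k c} (f g : Fin k → ℚ) → (∀ i → ∣ f i - g i ∣ ≤ c) → ∣ sum f - sum g ∣ ≤ ℕ→ℚ k * c
  sum-close {k} {c} f g h = ∣∣≤ (one-sided f g λ i → ℚ.≤-trans (p≤∣p∣ _) (h i))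
    (subst (_≤ ℕ→ℚ k * c) (solve 2 (λ a b → b :- a := :- (a :- b)) refl (sum f) (sum g))
      (one-sided g f λ i → ℚ.≤-trans (p≤∣p∣ _) (subst (_≤ c) (∣p-q∣≡∣q-p∣ (f i) (g i)) (h i))))
    where
    sum-minus : ∀ {k} (f g : Fin k → ℚ) → sum (λ i → f i - g i) ≡ sum f - sum g
    sum-minus {zero}  f g = refl
    sum-minus {suc k} f g = trans (cong (f zero - g zero ℚ.+_) (sum-minus (λ i → f (suc i)) (λ i → g (suc i))))
      (solve 4 (λ a b c d → a :- b :+ (c :- d) := a :+ c :- (b :+ d)) refl (f zero) (g zero) _ _)
    one-sided : ∀ (f g : Fin k → ℚ) → (∀ i → f i - g i ≤ c) → sum f - sum g ≤ ℕ→ℚ k * c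
    one-sided f g h = subst (_≤ ℕ→ℚ k * c) (sum-minus f g) (sum-≤ (λ i → f i - g i) h)

  0≤sum : ∀ {k} (f : Fin k → ℚ) → (∀ i → 0ℚ ≤ f i) → 0ℚ ≤ sum f
  0≤sum {zero}  f h = ℚ.≤-refl
  0≤sum {suc k} f h = 0≤-+ (h zero) (0≤sum (λ i → f (suc i)) (λ i → h (suc i)))

  term≤sum : ∀ {k} (f : Fin k → ℚ) → (∀ i → 0ℚ ≤ f i) → ∀ i → f i ≤ sum f
  term≤sum f h zero    = ≤-by (0≤sum (λ i → f (suc i)) (λ i → h (suc i))) refl
  term≤sum f h (suc i) = ≤-by (0≤-+ (0≤q-p (term≤sum (λ i → f (suc i)) (λ i → h (suc i)) i)) (h zero))
    (solve 3 (λ z s t → z :+ s := t :+ ((s :- t) :+ z)) refl (f zero) (sum λ j → f (suc j)) (f (suc i)))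

  sumSq : ∀ {k} → (Fin k → ℚ) → ℚ
  sumSq f = sum (λ i → f i * f i)

  0≤sumSq : ∀ {k} (f : Fin k → ℚ) → 0ℚ ≤ sumSq f
  0≤sumSq f = 0≤sum (λ i → f i * f i) (λ i → 0≤p*p (f i))

  sumSq-scale : ∀ {k} c (f : Fin k → ℚ) → sumSq (λ i → f i * c) ≡ sumSq f * (c * c)
  sumSq-scale c f = trans
    (sum-cong-≗ λ i → solve 2 (λ x c → (x :* c) :* (x :* c) := (x :* x) :* (c :* c)) refl (f i) c)
    (sym (*-distribʳ-sum (c * c) (λ i → f i * f i)))

  -- Comparison of a rescaled vector with a nearly unit vector

  -- Factoring the difference of squares gives the bound `3c (3c + 4) = 9c² + 12c`, and `c ≤ 1`
  -- turns it into `21c`.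
  square-close : ∀ {p q c} → c ≤ 1ℚ → ∣ q ∣ ≤ 2ℚ → ∣ p - q ∣ ≤ 3ℚ * c → ∣ p * p - q * q ∣ ≤ 21ℚ * c
  square-close {p} {q} {c} c≤1 q≤2 p-q≤ = begin
    ∣ p * p - q * q ∣
      ≡⟨ cong ∣_∣ (solve 2 (λ p q → p :* p :- q :* q := (p :- q) :* ((p :- q) :+ (q :+ q))) refl p q) ⟩
    ∣ (p - q) * ((p - q) + (q + q)) ∣
      ≤⟨ ∣p*q∣≤ {p - q} {(p - q) + (q + q)} p-q≤ (∣p+q∣≤ {p - q} {q + q} p-q≤ (∣p+q∣≤ {q} {q} q≤2 q≤2)) ⟩
    3ℚ * c * (3ℚ * c + (2ℚ + 2ℚ))
      ≤⟨ ≤-by (0≤-* (ℚ.nonNegative⁻¹ (+ 9 / 1)) (0≤-* 0≤c (0≤q-p c≤1)))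
          (solve 1 (λ c → con 21ℚ :* c := con 3ℚ :* c :* (con 3ℚ :* c :+ (con 2ℚ :+ con 2ℚ))
             :+ con (+ 9 / 1) :* (c :* (con 1ℚ :- c))) refl c) ⟩
    21ℚ * c ∎
    where
    open ℚ.≤-Reasoning
    0≤c : 0ℚ ≤ c
    0≤c = ℚ.*-cancelˡ-≤-pos 3ℚ (subst (_≤ 3ℚ * c) (sym (ℚ.*-zeroʳ 3ℚ)) (ℚ.≤-trans (ℚ.0≤∣p∣ (p - q)) p-q≤))

  -- Here y is a unit vector up to δ, and r y is within 3δ of the unit vector X;
  -- comparing lengths gives r ≈ 1.
  module _ {k} {δ r} (y X : Fin k → ℚ) (0≤δ : 0ℚ ≤ δ) (0≤r : 0ℚ ≤ r)
    (near : ∀ i → ∣ y i * r - X i ∣ ≤ 3ℚ * δ)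
    (∣X∣≤2 : ∀ i → ∣ X i ∣ ≤ 2ℚ) (S≈1 : ∣ sumSq X - 1ℚ ∣ ≤ 8ℚ * δ)
    (1≤v : 1ℚ ≤ sumSq y) (v≤ : sumSq y ≤ (1ℚ + δ) * (1ℚ + δ))
    where

    private
      -- `ρ` bounds the distance of `B`, the squared length of `r y`, from 1: `21 δ` from
      -- `square-close` for each of the `k` coordinates, and `8 δ` for the deviation of `sumSq X`
      -- itself.
      κ ρ v B : ℚ
      κ = ℕ→ℚ k
      ρ = (21ℚ * κ + 8ℚ) * δ
      v = sumSq y
      B = sumSq (λ i → y i * r)

    -- After multiplication by `r` the difference splits as `(y r - X) + (1 - r) X`, of size at most
    -- `3 δ + 4 ρ`. Since `ρ` dominates `8 δ`, this is at most `5 ρ`, and `r ≥ ½` permits division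
    -- by `r` at the cost of a factor 2. The hypothesis on `ρ` is what keeps `r` above `½`.
    direction-close : 4ℚ * ρ ≤ 1ℚ → ∀ i → ∣ y i - X i ∣ ≤ 10ℚ * ρ
    direction-close 4ρ≤1 i = ℚ.*-cancelʳ-≤-pos r {{positive (ℚ.<-≤-trans (ℚ.positive⁻¹ ½) ½≤r)}} (begin
      ∣ y i - X i ∣ * r
        ≡⟨ cong (∣ y i - X i ∣ *_) (ℚ.0≤p⇒∣p∣≡p 0≤r) ⟨
      ∣ y i - X i ∣ * ∣ r ∣
        ≡⟨ ℚ.∣p*q∣≡∣p∣*∣q∣ (y i - X i) r ⟨
      ∣ (y i - X i) * r ∣
        ≡⟨ cong ∣_∣ (solve 3 (λ y X r → (y :- X) :* r := (y :* r :- X) :+ (con 1ℚ :- r) :* X) refl (y i) (X i) r) ⟩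
      ∣ (y i * r - X i) + (1ℚ - r) * X i ∣
        ≤⟨ ∣p+q∣≤ {y i * r - X i} {(1ℚ - r) * X i} (near i)
             (∣p*q∣≤ {1ℚ - r} {X i} ∣1-r∣≤2ρ (∣X∣≤2 i)) ⟩
      3ℚ * δ + 2ℚ * ρ * 2ℚ
        ≤⟨ ≤-by (0≤-+ (0≤-+ (0≤q-p 8δ≤ρ) (0≤-* (ℚ.nonNegative⁻¹ (+ 5 / 1)) 0≤δ))
                   (0≤-* (0≤-* (ℚ.nonNegative⁻¹ 10ℚ) 0≤ρ) (0≤q-p ½≤r)))
            (solve 3 (λ ρ r δ → con 10ℚ :* ρ :* r :=
               con 3ℚ :* δ :+ con 2ℚ :* ρ :* con 2ℚ :+ ((ρ :- con 8ℚ :* δ) :+ con (+ 5 / 1) :* δ :+ con 10ℚ :* ρ :* (r :- con ½)))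
              refl ρ r δ) ⟩
      10ℚ * ρ * r ∎)
      where
      open ℚ.≤-Reasoning
      0≤κ : 0ℚ ≤ κ
      0≤κ = 0≤+/ k 0
      8δ≤ρ : 8ℚ * δ ≤ ρ
      8δ≤ρ = ≤-by (0≤-* (0≤-* (ℚ.nonNegative⁻¹ 21ℚ) 0≤κ) 0≤δ)
        (solve 2 (λ κ δ → (con 21ℚ :* κ :+ con 8ℚ) :* δ := con 8ℚ :* δ :+ con 21ℚ :* κ :* δ) refl κ δ)
      0≤ρ : 0ℚ ≤ ρ
      0≤ρ = ℚ.≤-trans (0≤-* (ℚ.nonNegative⁻¹ 8ℚ) 0≤δ) 8δ≤ρ
      ρ≤1 : ρ ≤ 1ℚ
      ρ≤1 = ≤-by (0≤-+ (0≤q-p 4ρ≤1) (0≤-* (ℚ.nonNegative⁻¹ 3ℚ) 0≤ρ))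
        (solve 1 (λ ρ → con 1ℚ := ρ :+ ((con 1ℚ :- con 4ℚ :* ρ) :+ con 3ℚ :* ρ)) refl ρ)
      δ≤1 : δ ≤ 1ℚ
      δ≤1 = ≤-by (0≤-+ (0≤-+ (0≤q-p ρ≤1) (0≤q-p 8δ≤ρ)) (0≤-* (ℚ.nonNegative⁻¹ (+ 7 / 1)) 0≤δ))
        (solve 2 (λ ρ δ → con 1ℚ := δ :+ ((con 1ℚ :- ρ) :+ (ρ :- con 8ℚ :* δ) :+ con (+ 7 / 1) :* δ)) refl ρ δ)
      ∣B-1∣≤ρ : ∣ B - 1ℚ ∣ ≤ ρ
      ∣B-1∣≤ρ = begin
        ∣ B - 1ℚ ∣
          ≡⟨ cong ∣_∣ (solve 2 (λ b s → b :- con 1ℚ := (b :- s) :+ (s :- con 1ℚ)) refl B (sumSq X)) ⟩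
        ∣ (B - sumSq X) + (sumSq X - 1ℚ) ∣
          ≤⟨ ∣p+q∣≤ {B - sumSq X} {sumSq X - 1ℚ}
               (sum-close (λ i → (y i * r) * (y i * r)) (λ i → X i * X i)
                 λ i → square-close {y i * r} {X i} δ≤1 (∣X∣≤2 i) (near i)) S≈1 ⟩
        κ * (21ℚ * δ) + 8ℚ * δ
          ≡⟨ solve 2 (λ κ δ → κ :* (con 21ℚ :* δ) :+ con 8ℚ :* δ := (con 21ℚ :* κ :+ con 8ℚ) :* δ) refl κ δ ⟩
        ρ ∎
      0≤1+ρ-B : 0ℚ ≤ ρ - (B - 1ℚ)
      0≤1+ρ-B = 0≤q-p (ℚ.≤-trans (p≤∣p∣ (B - 1ℚ)) ∣B-1∣≤ρ)
      0≤B-1+ρ : 0ℚ ≤ (B - 1ℚ) - - ρ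
      0≤B-1+ρ = 0≤q-p (∣p∣≤c⇒-c≤p {B - 1ℚ} ∣B-1∣≤ρ)
      B≡ : B ≡ v * (r * r)
      B≡ = sumSq-scale r y
      -- `r² ≤ v r² = B ≤ 1 + ρ ≤ (1 + ρ)²`, because `v ≥ 1`.
      r≤1+ρ : r ≤ 1ℚ + ρ
      r≤1+ρ = p*p≤q*q⇒p≤q (0≤-+ 0≤1 0≤ρ)
        (≤-by (0≤-+ (0≤-+ (0≤-* (0≤q-p 1≤v) (0≤p*p r))
                           (subst (λ b → 0ℚ ≤ ρ - (b - 1ℚ)) B≡ 0≤1+ρ-B)) (0≤-+ 0≤ρ (0≤p*p ρ)))
          (solve 3 (λ r ρ v → (con 1ℚ :+ ρ) :* (con 1ℚ :+ ρ) := r :* r :+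
             ((v :- con 1ℚ) :* (r :* r) :+ (ρ :- (v :* (r :* r) :- con 1ℚ)) :+ (ρ :+ ρ :* ρ))) refl r ρ v))
      -- `(1 - ρ)² ≤ 1 - ρ ≤ B = v r² ≤ (r (1 + δ))²`.
      1-ρ≤ : 1ℚ - ρ ≤ r * (1ℚ + δ)
      1-ρ≤ = p*p≤q*q⇒p≤q (0≤-* 0≤r (0≤-+ 0≤1 0≤δ))
        (≤-by (0≤-+ (0≤-+ (0≤-* (0≤q-p v≤) (0≤p*p r))
                           (subst (λ b → 0ℚ ≤ (b - 1ℚ) - - ρ) B≡ 0≤B-1+ρ)) (0≤-* 0≤ρ (0≤q-p ρ≤1)))
          (solve 4 (λ r ρ v δ → (r :* (con 1ℚ :+ δ)) :* (r :* (con 1ℚ :+ δ)) := (con 1ℚ :- ρ) :* (con 1ℚ :- ρ) :+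
             (((con 1ℚ :+ δ) :* (con 1ℚ :+ δ) :- v) :* (r :* r) :+ ((v :* (r :* r) :- con 1ℚ) :- :- ρ) :+ ρ :* (con 1ℚ :- ρ)))
            refl r ρ v δ))
      -- The loss `r δ` is at most `(1 + ρ) δ ≤ 2 δ`, which `ρ ≥ 8 δ` absorbs.
      1-2ρ≤r : 1ℚ - 2ℚ * ρ ≤ r
      1-2ρ≤r = ≤-by (0≤-+ (0≤-+ (0≤-+ (0≤q-p 1-ρ≤) (0≤-* (0≤q-p r≤1+ρ) 0≤δ)) (0≤-+ (0≤q-p 8δ≤ρ) (0≤-* 0≤δ (0≤q-p ρ≤1))))
                  (0≤-* (ℚ.nonNegative⁻¹ (+ 6 / 1)) 0≤δ))
        (solve 3 (λ r ρ δ → r := con 1ℚ :- con 2ℚ :* ρ :+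
           ((r :* (con 1ℚ :+ δ) :- (con 1ℚ :- ρ)) :+ (con 1ℚ :+ ρ :- r) :* δ :+ ((ρ :- con 8ℚ :* δ) :+ δ :* (con 1ℚ :- ρ))
            :+ con (+ 6 / 1) :* δ))
          refl r ρ δ)
      ½≤r : ½ ≤ r
      ½≤r = ≤-by (0≤-+ (0≤q-p 1-2ρ≤r) (0≤-* (ℚ.nonNegative⁻¹ ½) (0≤q-p 4ρ≤1)))
        (solve 2 (λ r ρ → r := con ½ :+ ((r :- (con 1ℚ :- con 2ℚ :* ρ)) :+ con ½ :* (con 1ℚ :- con 4ℚ :* ρ))) refl r ρ)
      ∣1-r∣≤2ρ : ∣ 1ℚ - r ∣ ≤ 2ℚ * ρ
      ∣1-r∣≤2ρ = ∣∣≤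
        (≤-by (0≤q-p 1-2ρ≤r) (solve 2 (λ r ρ → con 2ℚ :* ρ := con 1ℚ :- r :+ (r :- (con 1ℚ :- con 2ℚ :* ρ))) refl r ρ))
        (≤-by (0≤-+ (0≤q-p r≤1+ρ) 0≤ρ) (solve 2 (λ r ρ → con 2ℚ :* ρ := :- (con 1ℚ :- r) :+ ((con 1ℚ :+ ρ :- r) :+ ρ)) refl r ρ))

  -- Bounds for the rounded square root

  √ℚ-≤ : ∀ n {q p} → 0ℚ ≤ q → 0ℚ ≤ p → q ≤ p * p → √ℚ n q ≤ p
  √ℚ-≤ n {q} {p} 0≤q 0≤p q≤pp = p*p≤q*q⇒p≤q 0≤p
    (ℚ.≤-trans (subst (√ℚ n q * √ℚ n q ≤_) (ℚ.p≥q⇒p⊔q≡p 0≤q) (√ℚ-lower n q)) q≤pp)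

  √ℚ²-≥ : ∀ n {q} → 0ℚ ≤ q → q ≤ (√ℚ n q + 1/1+ n) * (√ℚ n q + 1/1+ n)
  √ℚ²-≥ n {q} 0≤q = ℚ.<⇒≤ (subst (_< (√ℚ n q + 1/1+ n) * (√ℚ n q + 1/1+ n)) (ℚ.p≥q⇒p⊔q≡p 0≤q) (√ℚ-upper n q))

  √ℚ-≥ : ∀ n {q p} → 0ℚ ≤ q → p * p ≤ q → p ≤ √ℚ n q + 1/1+ n
  √ℚ-≥ n {q} 0≤q pp≤q = p*p≤q*q⇒p≤q (0≤-+ (√ℚ-nonNeg n q) (0≤+/ 1 n)) (ℚ.≤-trans pp≤q (√ℚ²-≥ n 0≤q))

  -- Here `w` stands for a root rounded down with error `c`, so `q` lies between `w²` and
  -- `(w + c)²`. The worse side is the upper one: `(1 + 2δ)² - 1 = 4δ + 4δ² ≤ 8δ`.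
  square-near-1 : ∀ {q w c δ} → 0ℚ ≤ w → 0ℚ ≤ c → c ≤ δ → δ ≤ 1ℚ → ∣ w - 1ℚ ∣ ≤ δ →
    w * w ≤ q → q ≤ (w + c) * (w + c) → ∣ q - 1ℚ ∣ ≤ 8ℚ * δ
  square-near-1 {q} {w} {c} {δ} 0≤w 0≤c c≤δ δ≤1 w≈1 ww≤q q≤ = ∣∣≤
    (≤-by (0≤-+ (0≤-+ (0≤q-p q≤) (0≤q-p w+c≤²)) (0≤-* (ℚ.nonNegative⁻¹ 4ℚ) (0≤-* 0≤δ (0≤q-p δ≤1))))
      (solve 4 (λ q w c δ → con 8ℚ :* δ := q :- con 1ℚ :+
         (((w :+ c) :* (w :+ c) :- q) :+ ((con 1ℚ :+ con 2ℚ :* δ) :* (con 1ℚ :+ con 2ℚ :* δ) :- (w :+ c) :* (w :+ c))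
          :+ con 4ℚ :* (δ :* (con 1ℚ :- δ)))) refl q w c δ))
    (≤-by (0≤-+ (0≤-+ (0≤q-p ww≤q) (0≤q-p 1-δ≤²)) (0≤-+ (0≤p*p δ) (0≤-* (ℚ.nonNegative⁻¹ (+ 6 / 1)) 0≤δ)))
      (solve 3 (λ q w δ → con 8ℚ :* δ := :- (q :- con 1ℚ) :+
         ((q :- w :* w) :+ (w :* w :- (con 1ℚ :- δ) :* (con 1ℚ :- δ)) :+ (δ :* δ :+ con (+ 6 / 1) :* δ))) refl q w δ))
    where
    0≤δ : 0ℚ ≤ δ
    0≤δ = ℚ.≤-trans 0≤c c≤δ
    w+c≤ : w + c ≤ 1ℚ + 2ℚ * δ
    w+c≤ = ≤-by (0≤-+ (0≤q-p (ℚ.≤-trans (p≤∣p∣ (w - 1ℚ)) w≈1)) (0≤q-p c≤δ))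
      (solve 3 (λ w c δ → con 1ℚ :+ con 2ℚ :* δ := w :+ c :+ ((δ :- (w :- con 1ℚ)) :+ (δ :- c))) refl w c δ)
    w+c≤² : (w + c) * (w + c) ≤ (1ℚ + 2ℚ * δ) * (1ℚ + 2ℚ * δ)
    w+c≤² = *-mono-≤-nonNeg (0≤-+ 0≤w 0≤c) (ℚ.≤-trans (0≤-+ 0≤w 0≤c) w+c≤) w+c≤ w+c≤
    1-δ≤w : 1ℚ - δ ≤ w
    1-δ≤w = ≤-by (0≤q-p (∣p∣≤c⇒-c≤p {w - 1ℚ} w≈1))
      (solve 2 (λ w δ → w := con 1ℚ :- δ :+ (w :- con 1ℚ :- :- δ)) refl w δ)
    1-δ≤² : (1ℚ - δ) * (1ℚ - δ) ≤ w * w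
    1-δ≤² = *-mono-≤-nonNeg (0≤q-p δ≤1) 0≤w 1-δ≤w 1-δ≤w

  √ℚ-near-1 : ∀ n {q δ} → 0ℚ ≤ q → 1/1+ n ≤ δ → δ ≤ 1ℚ → ∣ √ℚ n q - 1ℚ ∣ ≤ δ → ∣ q - 1ℚ ∣ ≤ 8ℚ * δ
  √ℚ-near-1 n {q} 0≤q c≤δ δ≤1 h = square-near-1 {w = √ℚ n q} (√ℚ-nonNeg n q) (0≤+/ 1 n) c≤δ δ≤1 h
    (subst (√ℚ n q * √ℚ n q ≤_) (ℚ.p≥q⇒p⊔q≡p 0≤q) (√ℚ-lower n q)) (√ℚ²-≥ n 0≤q)

  0≤inv : ∀ {q} → 0ℚ < q → 0ℚ ≤ inv q
  0≤inv 0<q = ℚ.<⇒≤ (0<inv 0<q)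

  -- Dividing a vector by its rounded norm

  module Normalize {k} (a : Fin k → ℚ) (1≤Q : 1ℚ ≤ sumSq a) (n : ℕ) (c≤½ : 1/1+ n ≤ ½) where
    private
      c Q : ℚ
      c = 1/1+ n
      Q = sumSq a
      0≤c : 0ℚ ≤ c
      0≤c = 0≤+/ 1 n

    N : ℚ
    N = √ℚ n (sumSq a)

    y : Fin k → ℚ
    y i = a i * inv N

    -- The true norm is at least 1 and rounding loses at most `c ≤ ½`. So `N` is positive, `inv N`
    -- is a genuine inverse rather than the default 0, and it is at most 2.
    ½≤N : ½ ≤ N
    ½≤N = ≤-by (0≤-+ (0≤q-p (√ℚ-≥ n {p = 1ℚ} (0≤sumSq a) 1≤Q)) (0≤q-p c≤½))
      (solve 2 (λ N c → N := con ½ :+ ((N :+ c :- con 1ℚ) :+ (con ½ :- c))) refl N c)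

    0<N : 0ℚ < N
    0<N = ℚ.<-≤-trans (ℚ.positive⁻¹ ½) ½≤N

    private
      ι : ℚ
      ι = inv N
      Nι≡1 : N * ι ≡ 1ℚ
      Nι≡1 = *-inv 0<N
      ι≤2 : ι ≤ 2ℚ
      ι≤2 = ≤-by (0≤-* (ℚ.nonNegative⁻¹ 2ℚ) (0≤-* (0≤inv 0<N) (0≤q-p ½≤N)))
        (trans (cong (2ℚ *_) (sym Nι≡1))
          (solve 2 (λ N ι → con 2ℚ :* (N :* ι) := ι :+ con 2ℚ :* (ι :* (N :- con ½))) refl N ι))
      v≡ : sumSq y ≡ Q * (ι * ι)
      v≡ = sumSq-scale ι a

    -- Since `N` is rounded down, dividing by it can only leave the vector too long; `sumSq≤` bounds
    -- the excess.
    1≤sumSq : 1ℚ ≤ sumSq y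
    1≤sumSq = subst₂ _≤_ (trans (solve 2 (λ N ι → N :* N :* (ι :* ι) := (N :* ι) :* (N :* ι)) refl N ι) (cong₂ _*_ Nι≡1 Nι≡1))
      (sym v≡)
      (ℚ.*-monoʳ-≤-nonNeg (ι * ι) {{nonNegative (0≤p*p ι)}}
        (subst (N * N ≤_) (ℚ.p≥q⇒p⊔q≡p (0≤sumSq a)) (√ℚ-lower n Q)))

    sumSq≤ : sumSq y ≤ (1ℚ + 2ℚ * c) * (1ℚ + 2ℚ * c)
    sumSq≤ = begin
      sumSq y                              ≡⟨ v≡ ⟩
      Q * (ι * ι)                          ≤⟨ ℚ.*-monoʳ-≤-nonNeg (ι * ι) {{nonNegative (0≤p*p ι)}} (√ℚ²-≥ n (0≤sumSq a)) ⟩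
      (N + c) * (N + c) * (ι * ι)
        ≡⟨ solve 3 (λ N c ι → (N :+ c) :* (N :+ c) :* (ι :* ι) := (N :* ι :+ ι :* c) :* (N :* ι :+ ι :* c)) refl N c ι ⟩
      (N * ι + ι * c) * (N * ι + ι * c)    ≡⟨ cong (λ z → (z + ι * c) * (z + ι * c)) Nι≡1 ⟩
      (1ℚ + ι * c) * (1ℚ + ι * c)          ≤⟨ *-mono-≤-nonNeg 0≤l 0≤r l≤r l≤r ⟩
      (1ℚ + 2ℚ * c) * (1ℚ + 2ℚ * c)        ∎
      where
      open ℚ.≤-Reasoning
      0≤l : 0ℚ ≤ 1ℚ + ι * c
      0≤l = 0≤-+ 0≤1 (0≤-* (0≤inv 0<N) 0≤c)
      l≤r : 1ℚ + ι * c ≤ 1ℚ + 2ℚ * c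
      l≤r = ℚ.+-monoʳ-≤ 1ℚ (ℚ.*-monoʳ-≤-nonNeg c {{nonNegative 0≤c}} ι≤2)
      0≤r : 0ℚ ≤ 1ℚ + 2ℚ * c
      0≤r = ℚ.≤-trans 0≤l l≤r

    y≤ : ∀ i → y i ≤ 1ℚ + 2ℚ * c
    y≤ i = p*p≤q*q⇒p≤q (0≤-+ 0≤1 (0≤-* (ℚ.nonNegative⁻¹ 2ℚ) 0≤c))
      (ℚ.≤-trans (term≤sum (λ i → y i * y i) (λ i → 0≤p*p (y i)) i) sumSq≤)

    ∣√sumSq-1∣≤ : ∣ √ℚ n (sumSq y) - 1ℚ ∣ ≤ 2ℚ * c
    ∣√sumSq-1∣≤ = ∣∣≤
      (≤-shift {√ℚ n (sumSq y)} {1ℚ} {2ℚ * c} (√ℚ-≤ n (0≤sumSq y) (0≤-+ 0≤1 (0≤-* (ℚ.nonNegative⁻¹ 2ℚ) 0≤c)) sumSq≤))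
      (≤-by (0≤-+ (0≤q-p (√ℚ-≥ n {p = 1ℚ} (0≤sumSq y) 1≤sumSq)) 0≤c)
        (solve 2 (λ w c → con 2ℚ :* c := :- (w :- con 1ℚ) :+ ((w :+ c :- con 1ℚ) :+ c)) refl (√ℚ n (sumSq y)) c))

    -- With `u = 1/(d K)`, the factor `r = N u` of `direction-close` undoes the normalization: `y r`
    -- is the vector `a/(d K)`, which is known to be near `x`.
    y*r≡ : ∀ i u → y i * (N * u) ≡ a i * u
    y*r≡ i u = trans (solve 4 (λ a N ι u → a :* ι :* (N :* u) := (N :* ι) :* (a :* u)) refl (a i) N ι u)
      (trans (cong (_* (a i * u)) Nι≡1) (ℚ.*-identityˡ (a i * u)))

  -- Natural numbers in ℚ

  m/n*n≡m : ∀ m n → (+ m / suc n) * ℕ→ℚ (suc n) ≡ ℕ→ℚ m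
  m/n*n≡m m n = ℚ.toℚᵘ-injective (begin
    toℚᵘ ((+ m / suc n) * ℕ→ℚ (suc n))            ≈⟨ ℚ.toℚᵘ-homo-* (+ m / suc n) (ℕ→ℚ (suc n)) ⟩
    toℚᵘ (+ m / suc n) ℚᵘ.* toℚᵘ (ℕ→ℚ (suc n))    ≈⟨ ℚᵘ.*-cong (toℚᵘ-/ (+ m) n) (toℚᵘ-/ (+ suc n) 0) ⟩
    ℚᵘ.mkℚᵘ (+ m) n ℚᵘ.* ℚᵘ.mkℚᵘ (+ suc n) 0      ≈⟨ ℚᵘ.*≡* eq ⟩
    ℚᵘ.mkℚᵘ (+ m) 0                               ≈⟨ toℚᵘ-/ (+ m) 0 ⟨
    toℚᵘ (ℕ→ℚ m)                                  ∎)
    where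
    open import Relation.Binary.Reasoning.Setoid ℚᵘ.≃-setoid
    eq : (+ m ℤ.* + suc n) ℤ.* + 1 ≡ + m ℤ.* + (suc n ℕ.* 1)
    eq = trans (ℤ.*-identityʳ (+ m ℤ.* + suc n)) (cong (λ z → + m ℤ.* + z) (sym (ℕ.*-identityʳ (suc n))))

  ℕ→ℚ-mono : ∀ {m n} → m ℕ.≤ n → ℕ→ℚ m ≤ ℕ→ℚ n
  ℕ→ℚ-mono {m} {n} m≤n = ℚ.toℚᵘ-cancel-≤
    (ℚᵘ.≤-respˡ-≃ (ℚᵘ.≃-sym (toℚᵘ-/ (+ m) 0)) (ℚᵘ.≤-respʳ-≃ (ℚᵘ.≃-sym (toℚᵘ-/ (+ n) 0))
      (ℚᵘ.*≤* (ℤ.*-monoʳ-≤-nonNeg (+ 1) (ℤ.+≤+ m≤n)))))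

  ∃ℕ> : ∀ q → ∃[ n ] q < ℕ→ℚ n
  ∃ℕ> q with archimedean (0<inv 0<t)
    where
    0<t : 0ℚ < ∣ q ∣ + 1ℚ
    0<t = ℚ.+-mono-≤-< (ℚ.0≤∣p∣ q) (ℚ.positive⁻¹ 1ℚ)
  ... | n , h = suc n , (begin-strict
    q                              ≤⟨ p≤∣p∣ q ⟩
    ∣ q ∣                          <⟨ subst (_< t) (ℚ.+-identityʳ ∣ q ∣) (ℚ.+-monoʳ-< ∣ q ∣ (ℚ.positive⁻¹ 1ℚ)) ⟩
    t                              ≡⟨ trans (cong (t *_) (m/n*n≡m 1 n)) (ℚ.*-identityʳ t) ⟨
    t * (1/1+ n * ℕ→ℚ (suc n))     ≤⟨ ℚ.*-monoˡ-≤-nonNeg t {{nonNegative (ℚ.<⇒≤ 0<t)}}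
                                        (ℚ.*-monoʳ-≤-nonNeg (ℕ→ℚ (suc n)) {{nonNegative (0≤+/ (suc n) 0)}} (ℚ.<⇒≤ (h n ℕ.≤-refl))) ⟩
    t * (inv t * ℕ→ℚ (suc n))      ≡⟨ ℚ.*-assoc t (inv t) (ℕ→ℚ (suc n)) ⟨
    t * inv t * ℕ→ℚ (suc n)        ≡⟨ trans (cong (_* ℕ→ℚ (suc n)) (*-inv 0<t)) (ℚ.*-identityˡ (ℕ→ℚ (suc n))) ⟩
    ℕ→ℚ (suc n)                    ∎)
    where
    open ℚ.≤-Reasoning
    t : ℚ
    t = ∣ q ∣ + 1ℚ
    0<t : 0ℚ < t
    0<t = ℚ.+-mono-≤-< (ℚ.0≤∣p∣ q) (ℚ.positive⁻¹ 1ℚ)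

  -- Approximation of rationals by terms of the sequence

  close-below : ∀ {d t} → 0ℚ ≤ d → t ≤ d → - d ≤ t → ∣ d - t ∣ ≤ 2ℚ * d
  close-below {d} {t} 0≤d t≤d -d≤t = ∣∣≤
    (≤-by (0≤q-p -d≤t) (solve 2 (λ d t → con 2ℚ :* d := d :- t :+ (t :- :- d)) refl d t))
    (≤-by (0≤-+ (0≤q-p t≤d) (0≤-* (ℚ.nonNegative⁻¹ 2ℚ) 0≤d))
      (solve 2 (λ d t → con 2ℚ :* d := :- (d :- t) :+ ((d :- t) :+ con 2ℚ :* d)) refl d t))

  -- The gap containing `t` has length at most `δ x ≤ δ t ≤ 2 d`, so its left end is close enough.
  close-between : ∀ {x s t d δ} → 0ℚ ≤ d → 0ℚ ≤ δ → x ≤ t → t ≤ s → s ≤ x + δ * x → δ * t ≤ 2ℚ * d →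
    ∣ x - t ∣ ≤ 2ℚ * d
  close-between {x} {s} {t} {d} {δ} 0≤d 0≤δ x≤t t≤s step δt≤2d = ∣∣≤
    (≤-by (0≤-+ (0≤q-p x≤t) (0≤-* (ℚ.nonNegative⁻¹ 2ℚ) 0≤d))
      (solve 3 (λ x t d → con 2ℚ :* d := x :- t :+ ((t :- x) :+ con 2ℚ :* d)) refl x t d))
    (begin
      - (x - t)              ≡⟨ solve 2 (λ x t → :- (x :- t) := t :- x) refl x t ⟩
      t - x                  ≤⟨ ≤-shift {t} {x} (ℚ.≤-trans t≤s step) ⟩
      δ * x                  ≤⟨ ℚ.*-monoˡ-≤-nonNeg δ {{nonNegative 0≤δ}} x≤t ⟩
      δ * t                  ≤⟨ δt≤2d ⟩
      2ℚ * d                 ∎)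
    where open ℚ.≤-Reasoning

  module Approximation (α : ℕ → ℚ) (n≤α : ∀ n → ℕ→ℚ n ≤ α n) {δ : ℚ} (0≤δ : 0ℚ ≤ δ) (M : ℕ)
    (step : ∀ n → M ℕ.≤ n → α (suc n) ≤ α n + δ * α n) where

    private
      0≤d : 0ℚ ≤ α M
      0≤d = ℚ.≤-trans (0≤+/ M 0) (n≤α M)
      -- `f` is fuel: `n` climbs until the next term exceeds `t`, and `t < α (f + n)` guarantees
      -- that this happens before the fuel runs out.
      search : ∀ {t} f n → M ℕ.≤ n → α n ≤ t → t < α (f ℕ.+ n) →
               ∃[ m ] M ℕ.≤ m × α m ≤ t × t < α (suc m)
      search zero    n M≤n αn≤t t<αn = contradiction (ℚ.<-≤-trans t<αn αn≤t) (ℚ.<-irrefl refl)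
      search {t} (suc f) n M≤n αn≤t t<α with t ℚ.<? α (suc n)
      ... | yes t<αsn = n , M≤n , αn≤t , t<αsn
      ... | no  t≮αsn = search f (suc n) (ℕ.m≤n⇒m≤1+n M≤n) (ℚ.≮⇒≥ t≮αsn)
                                      (subst (λ j → t < α j) (sym (ℕ.+-suc f n)) t<α)

      bracket : ∀ {t} → ∃[ f ] t < ℕ→ℚ f → α M ≤ t → ∃[ m ] M ℕ.≤ m × α m ≤ t × t < α (suc m)
      bracket (f , t<f) d≤t = search f M ℕ.≤-refl d≤t
        (ℚ.<-≤-trans t<f (ℚ.≤-trans (ℕ→ℚ-mono (ℕ.m≤m+n f M)) (n≤α (f ℕ.+ M))))

      close : ∀ {t} → δ * t ≤ 2ℚ * α M → ∃[ m ] M ℕ.≤ m × α m ≤ t × t < α (suc m) →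
              ∃[ n ] ∣ α n - t ∣ ≤ 2ℚ * α M
      close δt≤2d (n , M≤n , αn≤t , t<αsn) =
        n , close-between 0≤d 0≤δ αn≤t (ℚ.<⇒≤ t<αsn) (step n M≤n) δt≤2d

    approximate : ∀ t → - α M ≤ t → δ * t ≤ 2ℚ * α M → ∃[ n ] ∣ α n - t ∣ ≤ 2ℚ * α M
    approximate t -d≤t δt≤2d with ℚ.≤-total (α M) t
    -- Targets up to `α M` take `α M` itself. Among them are those from vanishing coordinates, whose
    -- rational approximants may be slightly negative.
    ... | inj₂ t≤d = M , close-below 0≤d t≤d -d≤t
    ... | inj₁ d≤t = close δt≤2d (bracket (∃ℕ> t) d≤t)

  -- Halving `δ` leaves room for inversion: `q ≥ 1 - δ/2`, and `(1 + δ)(1 - δ/2) ≥ 1` as long as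
  -- `δ ≤ 1`.
  quotient-step : ∀ {q α α′ δ} → 0ℚ ≤ δ → δ ≤ 1ℚ → 0ℚ ≤ α′ → q * α′ ≡ α → ∣ q - 1ℚ ∣ ≤ ½ * δ → α′ ≤ α + δ * α
  quotient-step {q} {α′ = α′} {δ} 0≤δ δ≤1 0≤α′ refl h = ≤-by
    (0≤-* (0≤-+ (0≤-* (0≤-+ 0≤1 0≤δ) (0≤q-p (∣p∣≤c⇒-c≤p {q - 1ℚ} h))) (0≤-* (ℚ.nonNegative⁻¹ ½) (0≤-* 0≤δ (0≤q-p δ≤1)))) 0≤α′)
    (solve 3 (λ q x δ → q :* x :+ δ :* (q :* x) := x :+
       ((con 1ℚ :+ δ) :* (q :- con 1ℚ :- :- (con ½ :* δ)) :+ con ½ :* (δ :* (con 1ℚ :- δ))) :* x) refl q α′ δ)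

  small-multiple : ∀ {C ε} → 0ℚ < C → 0ℚ < ε → ∃[ N ] ∀ n → N ℕ.≤ n → C * 1/1+ n < ε
  small-multiple {C} {ε} 0<C 0<ε =
    proj₁ arch , λ n N≤n → begin-strict
      C * 1/1+ n       <⟨ ℚ.*-monoʳ-<-pos C {{positive 0<C}} (proj₂ arch n N≤n) ⟩
      C * (inv C * ε)  ≡⟨ ℚ.*-assoc C (inv C) ε ⟨
      C * inv C * ε    ≡⟨ cong (_* ε) (*-inv 0<C) ⟩
      1ℚ * ε           ≡⟨ ℚ.*-identityˡ ε ⟩
      ε                ∎
    where
    open ℚ.≤-Reasoning
    arch = archimedean (0<p*q (0<inv 0<C) 0<ε)

  -- Targets `d K X` and division by `d K`

  lower-target : ∀ {d K X δ} → 0ℚ ≤ d → 0ℚ ≤ K → δ * K ≡ 1ℚ → - δ ≤ X → - d ≤ d * K * X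
  lower-target {d} {K} {X} {δ} 0≤d 0≤K δK≡1 -δ≤X = ≤-by (0≤-* (0≤-* 0≤d 0≤K) (0≤q-p -δ≤X)) (begin
    d * K * X                                ≡⟨ solve 4 (λ d K X δ →
      d :* K :* X := :- (d :* (δ :* K)) :+ d :* K :* (X :- :- δ)) refl d K X δ ⟩
    - (d * (δ * K)) + d * K * (X - - δ)      ≡⟨ cong (λ z → - (d * z) + d * K * (X - - δ)) δK≡1 ⟩
    - (d * 1ℚ) + d * K * (X - - δ)           ≡⟨ cong (λ z → - z + d * K * (X - - δ)) (ℚ.*-identityʳ d) ⟩
    - d + d * K * (X - - δ)                  ∎)
    where open ≡-Reasoning

  upper-target : ∀ {d K X δ} → 0ℚ ≤ d → δ * K ≡ 1ℚ → X ≤ 2ℚ → δ * (d * K * X) ≤ 2ℚ * d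
  upper-target {d} {K} {X} {δ} 0≤d δK≡1 X≤2 = begin
    δ * (d * K * X)  ≡⟨ solve 4 (λ d K X δ → δ :* (d :* K :* X) := (δ :* K) :* (X :* d)) refl d K X δ ⟩
    δ * K * (X * d)  ≡⟨ trans (cong (_* (X * d)) δK≡1) (ℚ.*-identityˡ (X * d)) ⟩
    X * d            ≤⟨ ℚ.*-monoʳ-≤-nonNeg d {{nonNegative 0≤d}} X≤2 ⟩
    2ℚ * d           ∎
    where open ℚ.≤-Reasoning

  -- `X` is the coordinate at the stage where `a` was chosen and `X′` the same coordinate at a later
  -- stage. The choice contributes `2 d u = 2 δ` and the drift between stages `δ`.
  rescale : ∀ {a d K u X X′ δ} → 0ℚ ≤ u → d * K * u ≡ 1ℚ → δ * K ≡ 1ℚ →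
    ∣ a - d * K * X ∣ ≤ 2ℚ * d → ∣ X′ - X ∣ ≤ δ → ∣ a * u - X′ ∣ ≤ 3ℚ * δ
  rescale {a} {d} {K} {u} {X} {X′} {δ} 0≤u dKu≡1 δK≡1 a≈ X′≈X = begin
    ∣ a * u - X′ ∣
      ≡⟨ cong (λ z → ∣ a * u - z ∣) (trans (cong (_* X′) dKu≡1) (ℚ.*-identityˡ X′)) ⟨
    ∣ a * u - d * K * u * X′ ∣
      ≡⟨ cong ∣_∣ (solve 6 (λ a d K u X X′ → a :* u :- d :* K :* u :* X′ :=
           (a :- d :* K :* X) :* u :+ (d :* K :* u) :* (X :- X′)) refl a d K u X X′) ⟩
    ∣ (a - d * K * X) * u + (d * K * u) * (X - X′) ∣
      ≤⟨ ∣p+q∣≤ {(a - d * K * X) * u} {(d * K * u) * (X - X′)}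
           (∣p*q∣≤ {a - d * K * X} {u} a≈ (ℚ.≤-reflexive (ℚ.0≤p⇒∣p∣≡p 0≤u)))
           (ℚ.≤-reflexive (cong ∣_∣ (trans (cong (_* (X - X′)) dKu≡1) (ℚ.*-identityˡ (X - X′))))) ⟩
    2ℚ * d * u + ∣ X - X′ ∣
      ≤⟨ ℚ.+-mono-≤ (ℚ.≤-reflexive 2du≡2δ) (subst (_≤ δ) (∣p-q∣≡∣q-p∣ X′ X) X′≈X) ⟩
    2ℚ * δ + δ
      ≡⟨ solve 1 (λ δ → con 2ℚ :* δ :+ δ := con 3ℚ :* δ) refl δ ⟩
    3ℚ * δ ∎
    where
    open ℚ.≤-Reasoning
    2du≡2δ : 2ℚ * d * u ≡ 2ℚ * δ
    2du≡2δ = begin-equality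
      2ℚ * d * u                ≡⟨ ℚ.*-identityˡ (2ℚ * d * u) ⟨
      1ℚ * (2ℚ * d * u)         ≡⟨ cong (_* (2ℚ * d * u)) δK≡1 ⟨
      δ * K * (2ℚ * d * u)      ≡⟨ solve 4 (λ δ K d u →
        δ :* K :* (con 2ℚ :* d :* u) := (d :* K :* u) :* (con 2ℚ :* δ)) refl δ K d u ⟩
      d * K * u * (2ℚ * δ)      ≡⟨ cong (_* (2ℚ * δ)) dKu≡1 ⟩
      1ℚ * (2ℚ * δ)             ≡⟨ ℚ.*-identityˡ (2ℚ * δ) ⟩
      2ℚ * δ                    ∎

  -- With ρ = (21k + 8)δ as in direction-close, C δ = 10 k ρ.
  C : ℕ → ℚ
  C k = 10ℚ * (ℕ→ℚ k * (21ℚ * ℕ→ℚ k + 8ℚ))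

  module _ {k} (1≤k : 1 ℕ.≤ k) where
    private
      κ : ℚ
      κ = ℕ→ℚ k
      1≤κ : 1ℚ ≤ κ
      1≤κ = ℕ→ℚ-mono 1≤k
      0≤κ : 0ℚ ≤ κ
      0≤κ = ℚ.≤-trans 0≤1 1≤κ
      0<21κ+8 : 0ℚ < 21ℚ * κ + 8ℚ
      0<21κ+8 = ℚ.+-mono-≤-< (0≤-* (ℚ.nonNegative⁻¹ 21ℚ) 0≤κ) (ℚ.positive⁻¹ 8ℚ)

    0<C : 0ℚ < C k
    0<C = 0<p*q (ℚ.positive⁻¹ 10ℚ) (0<p*q (ℚ.<-≤-trans (ℚ.positive⁻¹ 1ℚ) 1≤κ) 0<21κ+8)

    4ρ≤1 : ∀ {δ} → 0ℚ ≤ δ → C k * δ ≤ 1ℚ → 4ℚ * ((21ℚ * κ + 8ℚ) * δ) ≤ 1ℚ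
    4ρ≤1 {δ} 0≤δ Cδ≤1 = ℚ.≤-trans
      (≤-by (0≤-+ (0≤-* (0≤-* (ℚ.nonNegative⁻¹ 10ℚ) (0≤q-p 1≤κ)) 0≤ρ) (0≤-* (ℚ.nonNegative⁻¹ (+ 6 / 1)) 0≤ρ))
        (solve 3 (λ κ s δ → con 10ℚ :* (κ :* s) :* δ := con 4ℚ :* (s :* δ) :+
           (con 10ℚ :* (κ :- con 1ℚ) :* (s :* δ) :+ con (+ 6 / 1) :* (s :* δ))) refl κ (21ℚ * κ + 8ℚ) δ))
      Cδ≤1
      where
      0≤ρ : 0ℚ ≤ (21ℚ * κ + 8ℚ) * δ
      0≤ρ = 0≤-* (ℚ.<⇒≤ 0<21κ+8) 0≤δ

    -- Since `κ ≥ 1`, `κ η² ≤ (κ η)²`; trading the factor `√k` for `k` keeps the bound rational.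
    sumSq-small : ∀ {δ e} (f : Fin k → ℚ) → 0ℚ ≤ δ → C k * δ ≤ e →
      (∀ i → ∣ f i ∣ ≤ 10ℚ * ((21ℚ * κ + 8ℚ) * δ)) → sumSq f ≤ e * e
    sumSq-small {δ} {e} f 0≤δ Cδ≤e f≤ = begin
      sumSq f                  ≤⟨ sum-≤ (λ i → f i * f i) (λ i → ∣p∣≤c⇒p*p≤c*c {f i} (f≤ i)) ⟩
      κ * (η * η)              ≤⟨ ≤-by (0≤-* (0≤-* (0≤q-p 1≤κ) 0≤κ) (0≤p*p η))
                                   (solve 2 (λ κ η →
        (κ :* η) :* (κ :* η) := κ :* (η :* η) :+ (κ :- con 1ℚ) :* κ :* (η :* η)) refl κ η) ⟩
      (κ * η) * (κ * η)        ≡⟨ cong (λ z → z * z) κη≡Cδ ⟩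
      (C k * δ) * (C k * δ)    ≤⟨ *-mono-≤-nonNeg 0≤Cδ (ℚ.≤-trans 0≤Cδ Cδ≤e) Cδ≤e Cδ≤e ⟩
      e * e                    ∎
      where
      open ℚ.≤-Reasoning
      η : ℚ
      η = 10ℚ * ((21ℚ * κ + 8ℚ) * δ)
      κη≡Cδ : κ * η ≡ C k * δ
      κη≡Cδ = solve 3 (λ κ s δ → κ :* (con 10ℚ :* (s :* δ)) := con 10ℚ :* (κ :* s) :* δ) refl κ (21ℚ * κ + 8ℚ) δ
      0≤Cδ : 0ℚ ≤ C k * δ
      0≤Cδ = 0≤-* (ℚ.<⇒≤ 0<C) 0≤δ

open import Defs
open import Data.Vec.Functional using (Vector; foldr)
open import Relation.Unary using (Pred; _∈_; _∩_; Satisfiable)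
open Estimates

-- Properties holding along a tail

Eventually : (ℕ → Set) → Set
Eventually P = ∃[ N ] ∀ n → N ℕ.≤ n → P n

Eventually-map : ∀ {P Q} → (∀ n → P n → Q n) → Eventually P → Eventually Q
Eventually-map f (N , p) = N , λ n N≤n → f n (p n N≤n)

infixr 4 _⊗_

_⊗_ : ∀ {P Q} → Eventually P → Eventually Q → Eventually (λ n → P n × Q n)
(M , p) ⊗ (N , q) = M ℕ.⊔ N , λ n h → p n (ℕ.m⊔n≤o⇒m≤o M N h) , q n (ℕ.m⊔n≤o⇒n≤o M N h)

Eventually-all : ∀ {k} {P : Fin k → ℕ → Set} → (∀ i → Eventually (P i)) → Eventually (λ n → ∀ i → P i n)
Eventually-all {zero}  h = 0 , λ _ _ ()
Eventually-all {suc k} h = Eventually-map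
  (λ _ → λ { (p , q) zero → p ; (p , q) (suc i) → q i })
  (h zero ⊗ Eventually-all (λ i → h (suc i)))

Eventually-above : ∀ m → Eventually (m ℕ.≤_)
Eventually-above m = m , λ _ m≤n → m≤n

-- Norms read off from coordinates at stage n

coords : ∀ {k} → ℝ^ k → ℕ → Fin k → ℚ
coords x n i = seq (x i) n

seq-‖‖ : ∀ {k} (x : ℝ^ k) n → seq ‖ x ‖ n ≡ √ℚ n (sumSq (coords x n))
seq-‖‖ x n = cong (√ℚ n) (seq-sum (λ i → x i * x i))
  where
  seq-sum : ∀ {k} (f : ℝ^ k) → seq (foldr _+_ 0ℝ f) n ≡ sum (coords f n)
  seq-sum {zero}  f = refl
  seq-sum {suc k} f = cong (seq (f zero) n ℚ.+_) (seq-sum (λ i → f (suc i)))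

-- A strict inequality of reals needs a persistent gap, so the room `e₀` below `ε` is halved: one
-- half bounds the norm, the other is the gap.
‖‖<-intro : ∀ {k} (x : ℝ^ k) {ε e₀} → 0ℚ ℚ.< e₀ → Eventually (λ n → 0ℚ ℚ.+ e₀ ℚ.≤ seq ε n) →
  Eventually (λ n → sumSq (coords x n) ℚ.≤ ½ ℚ.* e₀ ℚ.* (½ ℚ.* e₀)) → ‖ x ‖ < ε
‖‖<-intro x {ε} {e₀} 0<e₀ e₀≤ε small = e , 0<e , Eventually-map bound (e₀≤ε ⊗ small)
  where
  open ℚ.≤-Reasoning
  e : ℚ
  e = ½ ℚ.* e₀
  0<e : 0ℚ ℚ.< e
  0<e = Rationals.0<½ε 0<e₀
  bound : ∀ n → 0ℚ ℚ.+ e₀ ℚ.≤ seq ε n × sumSq (coords x n) ℚ.≤ e ℚ.* e → seq ‖ x ‖ n ℚ.+ e ℚ.≤ seq ε n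
  bound n (e₀≤ , small) = begin
    seq ‖ x ‖ n ℚ.+ e                     ≡⟨ cong (ℚ._+ e) (seq-‖‖ x n) ⟩
    √ℚ n (sumSq (coords x n)) ℚ.+ e       ≤⟨ ℚ.+-monoˡ-≤ e (√ℚ-≤ n (0≤sumSq (coords x n)) (ℚ.<⇒≤ 0<e) small) ⟩
    e ℚ.+ e                               ≡⟨ trans (Rationals.½ε+½ε≡ε e₀) (sym (ℚ.+-identityˡ e₀)) ⟩
    0ℚ ℚ.+ e₀                             ≤⟨ e₀≤ ⟩
    seq ε n                               ∎

val-pos : ∀ (a : ℕ⁺) → 1 ℕ.≤ val a
val-pos (mkℕ⁺ (suc n)) = ℕ.s≤s ℕ.z≤n

/⁺-* : ∀ a b → (a /⁺ b) ℚ.* ℕ→ℚ (val b) ≡ ℕ→ℚ (val a)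
/⁺-* (mkℕ⁺ m) (mkℕ⁺ (suc n)) = m/n*n≡m m n

-- The point `a/‖a‖` on the sphere

module Direction {k} (a : Vector ℕ⁺ (suc k)) where

  entries : Fin (suc k) → ℚ
  entries i = ℕ→ℚ (val (a i))

  1≤entries : ∀ i → 1ℚ ℚ.≤ entries i
  1≤entries i = ℕ→ℚ-mono (val-pos (a i))

  1≤Q : 1ℚ ℚ.≤ sumSq entries
  1≤Q = ℚ.≤-trans
    (Rationals.*-mono-≤-nonNeg 0≤1 (ℚ.≤-trans 0≤1 (1≤entries zero)) (1≤entries zero) (1≤entries zero))
    (term≤sum (λ i → entries i ℚ.* entries i) (λ i → 0≤p*p (entries i)) zero)

  eventually-½ : Eventually (λ n → 1/1+ n ℚ.≤ ½)
  eventually-½ = Eventually-map (λ _ → ℚ.<⇒≤) (Rationals.archimedean (ℚ.positive⁻¹ ½))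

  eventually-2c : ∀ {ε} → 0ℚ ℚ.< ε → Eventually (λ n → 2ℚ ℚ.* 1/1+ n ℚ.< ε)
  eventually-2c = small-multiple (ℚ.positive⁻¹ 2ℚ)

  module N n (c≤½ : 1/1+ n ℚ.≤ ½) = Normalize entries 1≤Q n c≤½

  0<‖a‖ : 0ℝ < ‖ embed a ‖
  0<‖a‖ = ½ , ℚ.positive⁻¹ ½ , Eventually-map
    (λ n c≤½ → subst₂ ℚ._≤_ (sym (ℚ.+-identityˡ ½)) (sym (seq-‖‖ (embed a) n)) (N.½≤N n c≤½)) eventually-½

  direction : ℝ^ suc k
  direction i = (embed a i ÷ ‖ embed a ‖) 0<‖a‖

  coords-direction : ∀ n c≤½ i → coords direction n i ≡ N.y n c≤½ i
  coords-direction n c≤½ i = cong (λ s → entries i ℚ.* inv s) (seq-‖‖ (embed a) n)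

  sumSq-direction : ∀ n c≤½ → sumSq (coords direction n) ≡ sumSq (N.y n c≤½)
  sumSq-direction n c≤½ = sum-cong-≗ λ i → cong (λ z → z ℚ.* z) (coords-direction n c≤½ i)

  direction-∈-Sphere⁺ : direction ∈ Sphere⁺ (suc k)
  direction-∈-Sphere⁺ = (λ i → nonNeg i , ≤1 i) , unit
    where
    open ℚ.≤-Reasoning
    nonNeg : ∀ i → 0ℝ ≤ direction i
    nonNeg i ε 0<ε = Eventually-map (λ n c≤½ → begin
      0ℚ                              ≤⟨ 0≤-* (ℚ.≤-trans 0≤1 (1≤entries i)) (0≤inv (N.0<N n c≤½)) ⟩
      N.y n c≤½ i                     ≡⟨ coords-direction n c≤½ i ⟨
      seq (direction i) n             ≡⟨ ℚ.+-identityʳ (seq (direction i) n) ⟨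
      seq (direction i) n ℚ.+ 0ℚ      ≤⟨ ℚ.+-monoʳ-≤ (seq (direction i) n) (ℚ.<⇒≤ 0<ε) ⟩
      seq (direction i) n ℚ.+ ε       ∎) eventually-½
    -- At stage `n` a coordinate may exceed 1 by up to `2/(n+1)`, an excess that falls below any `ε`
    -- along a tail.
    ≤1 : ∀ i → direction i ≤ 1ℝ
    ≤1 i ε 0<ε = Eventually-map (λ n (c≤½ , 2c<ε) → begin
      seq (direction i) n             ≡⟨ coords-direction n c≤½ i ⟩
      N.y n c≤½ i                     ≤⟨ N.y≤ n c≤½ i ⟩
      1ℚ ℚ.+ 2ℚ ℚ.* 1/1+ n            ≤⟨ ℚ.+-monoʳ-≤ 1ℚ (ℚ.<⇒≤ 2c<ε) ⟩
      1ℚ ℚ.+ ε                        ∎) (eventually-½ ⊗ eventually-2c 0<ε)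
    unit : ‖ direction ‖ ≈ 1ℝ
    unit ε 0<ε = Eventually-map (λ n (c≤½ , 2c<ε) → begin-strict
      ℚ.∣ seq ‖ direction ‖ n ℚ.- 1ℚ ∣
        ≡⟨ cong (λ z → ℚ.∣ z ℚ.- 1ℚ ∣) (trans (seq-‖‖ direction n) (cong (√ℚ n) (sumSq-direction n c≤½))) ⟩
      ℚ.∣ √ℚ n (sumSq (N.y n c≤½)) ℚ.- 1ℚ ∣    ≤⟨ N.∣√sumSq-1∣≤ n c≤½ ⟩
      2ℚ ℚ.* 1/1+ n                            <⟨ 2c<ε ⟩
      ε                                        ∎) (eventually-½ ⊗ eventually-2c 0<ε)

-- A mesh δ = 1/K fine enough for accuracy e in ℝ^k.
record Precision (k : ℕ) (e : ℚ) : Set where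
  field
    δ K  : ℚ
    0<δ  : 0ℚ ℚ.< δ
    0<K  : 0ℚ ℚ.< K
    δK≡1 : δ ℚ.* K ≡ 1ℚ
    δ≤1  : δ ℚ.≤ 1ℚ
    Cδ≤1 : C k ℚ.* δ ℚ.≤ 1ℚ
    Cδ≤e : C k ℚ.* δ ℚ.≤ e

precision : ∀ {k e} → 1 ℕ.≤ k → 0ℚ ℚ.< e → Precision k e
precision {k} {e} 1≤k 0<e = fromTail
  (small-multiple (0<C 1≤k) (ℚ.positive⁻¹ 1ℚ) ⊗ small-multiple (0<C 1≤k) 0<e
    ⊗ Rationals.archimedean (ℚ.positive⁻¹ 1ℚ))
  where
  0<suc : ∀ n → 0ℚ ℚ.< ℕ→ℚ (suc n)
  0<suc n = ℚ.<-≤-trans (ℚ.positive⁻¹ 1ℚ) (ℕ→ℚ-mono {1} {suc n} (ℕ.s≤s ℕ.z≤n))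
  fromTail : Eventually (λ n → C k ℚ.* 1/1+ n ℚ.< 1ℚ × C k ℚ.* 1/1+ n ℚ.< e × 1/1+ n ℚ.< 1ℚ) → Precision k e
  fromTail (n , h) = record
    { δ    = 1/1+ n
    ; K    = ℕ→ℚ (suc n)
    ; 0<δ  = ℚ.*-cancelʳ-<-nonNeg (ℕ→ℚ (suc n)) {{ℚ.nonNegative (ℚ.<⇒≤ (0<suc n))}}
               (subst₂ ℚ._<_ (sym (ℚ.*-zeroˡ (ℕ→ℚ (suc n)))) (sym (m/n*n≡m 1 n)) (ℚ.positive⁻¹ 1ℚ))
    ; 0<K  = 0<suc n
    ; δK≡1 = m/n*n≡m 1 n
    ; δ≤1  = ℚ.<⇒≤ (proj₂ (proj₂ (h n ℕ.≤-refl)))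
    ; Cδ≤1 = ℚ.<⇒≤ (proj₁ (h n ℕ.≤-refl))
    ; Cδ≤e = ℚ.<⇒≤ (proj₁ (proj₂ (h n ℕ.≤-refl)))
    }

-- Approximation by the given sequence

Approximates : (ℕ → ℕ⁺) → ℚ → ℚ → Set
Approximates a δ d = ∀ t → ℚ.- d ℚ.≤ t → δ ℚ.* t ℚ.≤ 2ℚ ℚ.* d →
  ∃[ n ] ℚ.∣ ℕ→ℚ (val (a n)) ℚ.- t ∣ ℚ.≤ 2ℚ ℚ.* d

-- Each quotient is a constant Cauchy sequence, so an inequality between reals can be evaluated at
-- any one stage to give an inequality in ℚ.
quotients-close : ∀ a → quotients a ⟶ 1ℝ → ∀ {ε} → 0ℚ ℚ.< ε →
  Eventually (λ n → ℚ.∣ (a n /⁺ a (suc n)) ℚ.- 1ℚ ∣ ℚ.≤ ε)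
quotients-close a q⟶1 {ε} 0<ε = Eventually-map {Q = λ n → ℚ.∣ (a n /⁺ a (suc n)) ℚ.- 1ℚ ∣ ℚ.≤ ε}
  (λ n → constant-< ℚ.∣ (a n /⁺ a (suc n)) ℚ.- 1ℚ ∣)
  (q⟶1 (fromℚ ε) (ε , 0<ε , 0 , λ _ _ → ℚ.≤-reflexive (ℚ.+-identityˡ ε)))
  where
  constant-< : ∀ p → (∃[ γ ] 0ℚ ℚ.< γ × Eventually (λ _ → p ℚ.+ γ ℚ.≤ ε)) → p ℚ.≤ ε
  constant-< p (γ , 0<γ , N , h) = ℚ.≤-trans
    (subst (ℚ._≤ p ℚ.+ γ) (ℚ.+-identityʳ p) (ℚ.+-monoʳ-≤ p (ℚ.<⇒≤ 0<γ))) (h N ℕ.≤-refl)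

approximates : ∀ a → Increasing a → quotients a ⟶ 1ℝ → ∀ {δ} → 0ℚ ℚ.< δ → δ ℚ.≤ 1ℚ →
  ∃[ d ] 0ℚ ℚ.< d × Approximates a δ d
approximates a increasing q⟶1 {δ} 0<δ δ≤1 = fromTail (quotients-close a q⟶1 (Rationals.0<½ε 0<δ))
  where
  n≤a : ∀ n → n ℕ.≤ val (a n)
  n≤a zero    = ℕ.z≤n
  n≤a (suc n) = ℕ.≤-<-trans (n≤a n) (increasing n)
  fromTail : Eventually (λ n → ℚ.∣ (a n /⁺ a (suc n)) ℚ.- 1ℚ ∣ ℚ.≤ ½ ℚ.* δ) →
             ∃[ d ] 0ℚ ℚ.< d × Approximates a δ d
  fromTail (M , h) = ℕ→ℚ (val (a M))
    , ℚ.<-≤-trans (ℚ.positive⁻¹ 1ℚ) (ℕ→ℚ-mono (val-pos (a M)))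
    , Approximation.approximate (λ n → ℕ→ℚ (val (a n))) (λ n → ℕ→ℚ-mono (n≤a n)) (ℚ.<⇒≤ 0<δ) M
        λ n M≤n → quotient-step {a n /⁺ a (suc n)} (ℚ.<⇒≤ 0<δ) δ≤1 (Rationals.0≤+/ (val (a (suc n))) 0)
          (/⁺-* (a n) (a (suc n))) (h n M≤n)

-- A point of `D^ k A` close to `x`

module Near {k e} (p : Precision (suc k) e) (x : ℝ^ suc k) (x∈S : x ∈ Sphere⁺ (suc k)) where
  open Precision p

  private
    0≤δ : 0ℚ ℚ.≤ δ
    0≤δ = ℚ.<⇒≤ 0<δ

  -- The sphere conditions hold for the approximants only up to `δ`; the bound 2 comes from `1 + δ`
  -- with `δ ≤ 1`.
  InRange : ℕ → Set
  InRange n = (∀ i → ℚ.- δ ℚ.≤ seq (x i) n) × (∀ i → seq (x i) n ℚ.≤ 2ℚ) ×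
    ℚ.∣ √ℚ n (sumSq (coords x n)) ℚ.- 1ℚ ∣ ℚ.≤ δ

  -- Lets indices chosen from stage `m` alone serve every later stage.
  Settled : ℕ → Set
  Settled m = ∀ i n → m ℕ.≤ n → ℚ.∣ seq (x i) n ℚ.- seq (x i) m ∣ ℚ.≤ δ

  inRange : Eventually InRange
  inRange = Eventually-all lower ⊗ Eventually-all upper ⊗ unit
    where
    lower : ∀ i → Eventually (λ n → ℚ.- δ ℚ.≤ seq (x i) n)
    lower i = Eventually-map (λ n h → subst₂ ℚ._≤_ (ℚ.+-identityˡ (ℚ.- δ)) (cancel (seq (x i) n))
        (ℚ.+-monoˡ-≤ (ℚ.- δ) h))
      (proj₁ (proj₁ x∈S i) δ 0<δ)
      where
      open +-*-Solver
      cancel : ∀ p → p ℚ.+ δ ℚ.+ ℚ.- δ ≡ p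
      cancel p = solve 2 (λ p δ → p :+ δ :+ :- δ := p) refl p δ
    upper : ∀ i → Eventually (λ n → seq (x i) n ℚ.≤ 2ℚ)
    upper i = Eventually-map (λ n h → ℚ.≤-trans h (ℚ.+-monoʳ-≤ 1ℚ δ≤1)) (proj₂ (proj₁ x∈S i) δ 0<δ)
    unit : Eventually (λ n → ℚ.∣ √ℚ n (sumSq (coords x n)) ℚ.- 1ℚ ∣ ℚ.≤ δ)
    unit = Eventually-map (λ n h → subst (λ z → ℚ.∣ z ℚ.- 1ℚ ∣ ℚ.≤ δ) (seq-‖‖ x n) (ℚ.<⇒≤ h)) (proj₂ x∈S δ 0<δ)

  settled : Eventually Settled
  settled = Eventually-all λ i → proj₁ (cauchy (x i) δ 0<δ) ,
    λ m N≤m n m≤n → ℚ.<⇒≤ (proj₂ (cauchy (x i) δ 0<δ) n m (ℕ.≤-trans N≤m m≤n) N≤m)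

  module _ (b : Vector ℕ⁺ (suc k)) {d m} (0<d : 0ℚ ℚ.< d) (m-settled : Settled m)
    (b≈ : ∀ i → ℚ.∣ ℕ→ℚ (val (b i)) ℚ.- d ℚ.* K ℚ.* seq (x i) m ∣ ℚ.≤ 2ℚ ℚ.* d) where
    open Direction b

    private
      u : ℚ
      u = inv (d ℚ.* K)

      0<dK : 0ℚ ℚ.< d ℚ.* K
      0<dK = Rationals.0<p*q 0<d 0<K

      close : ∀ n → InRange n × (m ℕ.≤ n) × (1/1+ n ℚ.≤ ½) × (2ℚ ℚ.* 1/1+ n ℚ.< δ) →
        ∀ i → ℚ.∣ coords direction n i ℚ.- seq (x i) n ∣ ℚ.≤ 10ℚ ℚ.* ((21ℚ ℚ.* ℕ→ℚ (suc k) ℚ.+ 8ℚ) ℚ.* δ)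
      close n ((lower , upper , unit) , m≤n , c≤½ , 2c<δ) i =
        subst (λ z → ℚ.∣ z ℚ.- seq (x i) n ∣ ℚ.≤ 10ℚ ℚ.* ((21ℚ ℚ.* ℕ→ℚ (suc k) ℚ.+ 8ℚ) ℚ.* δ))
          (sym (coords-direction n c≤½ i))
          (direction-close {δ = δ} {N.N n c≤½ ℚ.* u} (N.y n c≤½) (coords x n) 0≤δ
            (0≤-* (ℚ.<⇒≤ (N.0<N n c≤½)) (0≤inv 0<dK)) near ∣x∣≤2
            (√ℚ-near-1 n {sumSq (coords x n)} {δ} (0≤sumSq (coords x n)) c≤δ δ≤1 unit)
            (N.1≤sumSq n c≤½) v≤ (4ρ≤1 {suc k} (ℕ.s≤s ℕ.z≤n) 0≤δ Cδ≤1) i)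
        where
        0≤c : 0ℚ ℚ.≤ 1/1+ n
        0≤c = Rationals.0≤+/ 1 n
        c≤δ : 1/1+ n ℚ.≤ δ
        c≤δ = ℚ.≤-trans (subst (ℚ._≤ 2ℚ ℚ.* 1/1+ n) (ℚ.*-identityˡ (1/1+ n))
          (ℚ.*-monoʳ-≤-nonNeg (1/1+ n) {{ℚ.nonNegative 0≤c}} (ℕ→ℚ-mono {1} {2} (ℕ.s≤s ℕ.z≤n)))) (ℚ.<⇒≤ 2c<δ)
        near : ∀ j → ℚ.∣ N.y n c≤½ j ℚ.* (N.N n c≤½ ℚ.* u) ℚ.- seq (x j) n ∣ ℚ.≤ 3ℚ ℚ.* δ
        near j = subst (λ z → ℚ.∣ z ℚ.- seq (x j) n ∣ ℚ.≤ 3ℚ ℚ.* δ) (sym (N.y*r≡ n c≤½ j u))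
          (rescale {entries j} {d} {K} {u} {seq (x j) m} {seq (x j) n} {δ}
            (0≤inv 0<dK) (Rationals.*-inv 0<dK) δK≡1 (b≈ j) (m-settled j n m≤n))
        ∣x∣≤2 : ∀ j → ℚ.∣ seq (x j) n ∣ ℚ.≤ 2ℚ
        ∣x∣≤2 j = Rationals.∣∣≤ (upper j) (ℚ.≤-trans
          (subst (ℚ.- seq (x j) n ℚ.≤_) (-‿involutive δ) (ℚ.neg-antimono-≤ (lower j)))
          (ℚ.≤-trans δ≤1 (ℕ→ℚ-mono {1} {2} (ℕ.s≤s ℕ.z≤n))))
          where
          open +-*-Solver
          -‿involutive : ∀ p → ℚ.- (ℚ.- p) ≡ p
          -‿involutive = solve 1 (λ p → :- :- p := p) refl
        l≤r : 1ℚ ℚ.+ 2ℚ ℚ.* 1/1+ n ℚ.≤ 1ℚ ℚ.+ δ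
        l≤r = ℚ.+-monoʳ-≤ 1ℚ (ℚ.<⇒≤ 2c<δ)
        v≤ : sumSq (N.y n c≤½) ℚ.≤ (1ℚ ℚ.+ δ) ℚ.* (1ℚ ℚ.+ δ)
        v≤ = ℚ.≤-trans (N.sumSq≤ n c≤½)
          (Rationals.*-mono-≤-nonNeg (0≤-+ 0≤1 (0≤-* (Rationals.0≤+/ 2 0) 0≤c)) (0≤-+ 0≤1 0≤δ) l≤r l≤r)

      Late : ℕ → Set
      Late n = InRange n × (m ℕ.≤ n) × (1/1+ n ℚ.≤ ½) × (2ℚ ℚ.* 1/1+ n ℚ.< δ)

      late : Eventually Late
      late = inRange ⊗ Eventually-above m ⊗ eventually-½ ⊗ eventually-2c 0<δ

      square-bound : ∀ n → Late n → sumSq (λ i → coords direction n i ℚ.- seq (x i) n) ℚ.≤ e ℚ.* e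
      square-bound n h = sumSq-small {suc k} (ℕ.s≤s ℕ.z≤n)
        (λ i → coords direction n i ℚ.- seq (x i) n) 0≤δ Cδ≤e (close n h)

    direction-near : Eventually (λ n → sumSq (coords (direction -ᵛ x) n) ℚ.≤ e ℚ.* e)
    direction-near = Eventually-map square-bound late

  near-direction : ∀ a → (∃[ d ] 0ℚ ℚ.< d × Approximates a δ d) → Eventually (λ m → InRange m × Settled m) →
    Σ[ s ∈ (Fin (suc k) → ℕ) ] Eventually (λ n → sumSq (coords (Direction.direction (λ i → a (s i)) -ᵛ x) n) ℚ.≤ e ℚ.* e)
  near-direction a (d , 0<d , approx) (m , h) =
    (λ i → proj₁ (choose i)) , direction-near (λ i → a (proj₁ (choose i))) 0<d (proj₂ at-m) (λ i → proj₂ (choose i))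
    where
    at-m : InRange m × Settled m
    at-m = h m ℕ.≤-refl
    choose : ∀ i → ∃[ n ] ℚ.∣ ℕ→ℚ (val (a n)) ℚ.- d ℚ.* K ℚ.* seq (x i) m ∣ ℚ.≤ 2ℚ ℚ.* d
    choose i = approx (d ℚ.* K ℚ.* seq (x i) m)
      (lower-target {d} {K} {seq (x i) m} {δ} (ℚ.<⇒≤ 0<d) (ℚ.<⇒≤ 0<K) δK≡1 (proj₁ (proj₁ at-m) i))
      (upper-target {d} {K} {seq (x i) m} {δ} (ℚ.<⇒≤ 0<d) δK≡1 (proj₁ (proj₂ (proj₁ at-m)) i))

theorem1p5 : ∀ {ℓ} (A : Pred ℕ⁺ ℓ) →
    (∃[ a ] (∀ n → a n ∈ A) × Increasing a × (quotients a ⟶ 1ℝ)) →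
    ∀ k → 2 ℕ.≤ k → D^ k A IsDenseIn Sphere⁺ k
theorem1p5 A (a , a∈A , increasing , q⟶1) (suc k) 2≤k V V-open (x , x∈V , x∈S) = inBall (V-open x x∈V)
  where
  inBall : (∃[ ε ] 0ℝ < ε × (∀ y → ‖ y -ᵛ x ‖ < ε → y ∈ V)) → Satisfiable (V ∩ Sphere⁺ (suc k) ∩ D^ (suc k) A)
  inBall (ε , (e₀ , 0<e₀ , e₀≤ε) , ball) =
      fromIndices (near-direction a (approximates a increasing q⟶1 0<δ δ≤1) (inRange ⊗ settled))
    where
    -- The accuracy is `½ e₀` because `‖‖<-intro` reserves the other half of `e₀` as the gap.
    p : Precision (suc k) (½ ℚ.* e₀)
    p = precision (ℕ.s≤s ℕ.z≤n) (Rationals.0<½ε 0<e₀)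
    open Precision p using (0<δ; δ≤1)
    open Near p x x∈S
    fromIndices : (Σ[ s ∈ (Fin (suc k) → ℕ) ] Eventually (λ n →
        sumSq (coords (Direction.direction (λ i → a (s i)) -ᵛ x) n) ℚ.≤ ½ ℚ.* e₀ ℚ.* (½ ℚ.* e₀))) →
      Satisfiable (V ∩ Sphere⁺ (suc k) ∩ D^ (suc k) A)
    fromIndices (s , near) =
      direction , ball direction (‖‖<-intro (direction -ᵛ x) {ε} 0<e₀ e₀≤ε near) , direction-∈-Sphere⁺ ,
      -- The point found is `a/‖a‖` itself, so its equality with `a/‖a‖` is reflexivity: the
      -- termwise differences are 0 from stage 0 on.
      (λ i → a (s i)) , (λ i → a∈A (s i)) , 0<‖a‖ , λ i ε 0<ε → 0 , λ n _ →
        subst (λ z → ℚ.∣ z ∣ ℚ.< ε) (sym (ℚ.+-inverseʳ (seq (direction i) n))) 0<ε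
      where
      open Direction (λ i → a (s i))
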